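{- For all positive integers $k$ and $d$ there exists $n$ with the following property: for every linear ordering $\prec$ of $[k]^n$ there is a $d$-subcube $C$ of $[k]^n$ such that the restriction of $\prec$ to $C$ (viewed, via the canonical bijection, as a linear ordering of $[k]^d$) equals $\prec_T$ on $[k]^d$ for some weakly decreasing Schröder tree $T$ with $k$ leaves and some linear ordering $<$ of $[k]$.
   Context: Elements of $[k]^n$ ($[k]=\{1,\dotsc,k\}$) are words of length $n$ over $[k]$. A $d$-parameter word of length $n$ is a word $p$ of length $n$ over $[k]\cup\{*_1,\dotsc,*_d\}$ containing each $*_i$ at least once; for a word $w$ of length $d$, $p[w]$ is obtained from $p$ by replacing each $*_i$ by $w_i$. The set $\{p[w]:w\in[k]^d\}$ is a $d$-subcube. A parameter word is canonical if the first occurrences of $*_1,*_2,\dotsc,*_d$ appear in this order; each $d$-subcube is induced by a unique canonical $p$, and $w\mapsto p[w]$ is the canonical bijection. The restriction of a linear ordering $\prec$ of $[k]^n$ to the subcube is the ordering on $[k]^d$ given by $w\prec w'$ iff $p[w]\prec p[w']$. A Schröder tree is a rooted plane tree (children of each node are ordered) in which every internal node has at least $2$ children. A weakly decreasing Schröder tree is a Schröder tree together with a total preorder $\preceq_T$ (transitive, reflexive, any two nodes comparable) on its internal nodes such that every path from the root is strictly decreasing with respect to $\preceq_T$. Given a linear ordering $<$ of $[k]$ and a weakly decreasing Schröder tree $T$ with $k$ leaves, identify the leaves (in their left-to-right plane order) with the elements of $[k]$ listed in increasing $<$-order. For distinct $a,b\in[k]$, $[a,b]_T$ denotes the lowest internal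 node of $T$ having both leaves $a$ and $b$ as descendants. The ordering $\prec_T$ on $[k]^d$: for distinct words $w,w'$, let $i$ be the smallest index with $w_i\neq w'_i$ such that $[w_j,w'_j]_T\preceq_T[w_i,w'_i]_T$ for all $j$ with $w_j\ne w'_j$; then $w\prec_T w'$ iff $w_i<w'_i$. -}

module Defs where

open import Level using (0ℓ)
open import Data.Nat as ℕ using (ℕ; zero; suc; _+_)
open import Data.Fin as Fin using (Fin; splitAt)
open import Data.Vec using (Vec; lookup; map)
open import Data.Sum using (_⊎_; inj₁; inj₂)
open import Data.Product using (Σ; ∃; _×_; _,_)
open import Relation.Binary.PropositionalEquality using (_≡_; _≢_)
open import Relation.Nullary using (¬_)
open import Relation.Binary.Core using (Rel)

Word : ℕ → ℕ → Set
Word k n = Vec (Fin k) n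

-- a word of length n over [k] ∪ {*_1,…,*_d}; inj₂ i stands for *_(i+1)
PWord : ℕ → ℕ → ℕ → Set
PWord k d n = Vec (Fin k ⊎ Fin d) n

IsParamWord : ∀ {k d n} → PWord k d n → Set
IsParamWord {d = d} {n = n} p = ∀ (i : Fin d) → ∃ λ (m : Fin n) → lookup p m ≡ inj₂ i

FirstOcc : ∀ {k d n} → PWord k d n → Fin d → Fin n → Set
FirstOcc p i m = (lookup p m ≡ inj₂ i) × (∀ m' → m' Fin.< m → lookup p m' ≢ inj₂ i)

Canonical : ∀ {k d n} → PWord k d n → Set
Canonical {d = d} {n = n} p =
  ∀ (i j : Fin d) (m m' : Fin n) → i Fin.< j → FirstOcc p i m → FirstOcc p j m' → m Fin.< m'

subst : ∀ {k d n} → PWord k d n → Word k d → Word k n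
subst p w = map f p
  where
  f : _ → _
  f (inj₁ a) = a
  f (inj₂ i) = lookup w i

-- Schröder trees with ranked internal nodes.
-- The total preorder ⪯_T on internal nodes is encoded by a rank in ℕ
-- attached to every internal node: u ⪯_T v iff rank u ≤ rank v.
-- STree m : trees with m leaves; Forest c m : c trees with m leaves total.

mutual
  data STree : ℕ → Set where
    leaf : STree 1
    node : ∀ {c m} → (r : ℕ) → Forest (suc (suc c)) m → STree m

  data Forest : ℕ → ℕ → Set where
    []  : Forest 0 0
    _∷_ : ∀ {a b c} → STree a → Forest c b → Forest (suc c) (a + b)

mutual
  Below : ∀ {m} → ℕ → STree m → Set
  Below r leaf = Data.Unit.⊤
    where import Data.Unit
  Below r (node r' f) = r' ℕ.< r

  WeaklyDecreasing : ∀ {m} → STree m → Set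
  WeaklyDecreasing leaf = Data.Unit.⊤
    where import Data.Unit
  WeaklyDecreasing (node r f) = WDF r f

  WDF : ∀ {c m} → ℕ → Forest c m → Set
  WDF r [] = Data.Unit.⊤
    where import Data.Unit
  WDF r (t ∷ f) = Below r t × WeaklyDecreasing t × WDF r f

-- rank of the lowest internal node having both leaves (given by
-- left-to-right position) as descendants; only meaningful for distinct leaves
mutual
  lcaRank : ∀ {m} → STree m → Fin m → Fin m → ℕ
  lcaRank leaf p q = 0
  lcaRank (node r f) p q = lcaRankF r f p q

  lcaRankF : ∀ {c m} → ℕ → Forest c m → Fin m → Fin m → ℕ
  lcaRankF r [] () q
  lcaRankF r (_∷_ {a} t f) p q with splitAt a p | splitAt a q
  ... | inj₁ p' | inj₁ q' = lcaRank t p' q'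
  ... | inj₂ p' | inj₂ q' = lcaRankF r f p' q'
  ... | _       | _       = r

-- The ordering ≺_T on [k]^d.
-- _<ₖ_ : the linear ordering < of [k];
-- pos a : the left-to-right position of the leaf identified with a
-- (leaves listed left to right = elements of [k] in increasing <-order).

PrecT : ∀ {k d} → Rel (Fin k) 0ℓ → (Fin k → Fin k) → STree k →
        Word k d → Word k d → Set
PrecT {d = d} _<ₖ_ pos T w w' =
  Σ (Fin d) λ i → P i × (∀ j → j Fin.< i → ¬ P j) × (lookup w i <ₖ lookup w' i)
  where
  D : Fin d → Set
  D j = lookup w j ≢ lookup w' j
  r : Fin d → ℕ
  r j = lcaRank T (pos (lookup w j)) (pos (lookup w' j))
  P : Fin d → Set
  P i = D i × (∀ j → D j → r j ℕ.≤ r i)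

{-# OPTIONS --safe #-}

-- By the Graham-Rothschild theorem for colourings of 1- and 2-parameter words, we pass to a cube in which the
-- comparison of q[u] with q[u'] depends only on u and u', not on the 1- or 2-parameter word q. Constant words order
-- the alphabet. Let "step s" replace the s-th letter by the next one. Comparing "raise s, lower t" for the two orders
-- in which s and t can first occur yields a total preorder on steps, and in a tie the step occurring first wins.
-- T is the Cartesian tree of the ranks of the steps. In the final cube every coordinate is repeated more than k times;
-- if w_i < w'_i at the decisive coordinate i, some step s from w_i towards w'_i has maximal rank, and one copy of
-- coordinate i performing s pays for all simultaneous lowerings by t in the other coordinates, for each t in turn.
module Submission where

open import Defs
open import Level using (0ℓ)
open import Data.Nat as ℕ using (ℕ; zero; suc; _+_; _*_; _^_; _⊔_; _⊓_; _≤_; _<_; z≤n; s≤s; _≤?_)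
import Data.Nat.Properties as ℕ
open import Data.Fin as Fin using (Fin; zero; suc; toℕ; fromℕ<; splitAt; remQuot; finToFun; funToFin; combine)
import Data.Fin.Properties as Fin
open import Data.Vec as Vec using (Vec; []; _∷_; lookup; toList; tabulate; replicate; _[_]≔_)
import Data.Vec.Properties as Vec
open import Data.Vec.Functional using () renaming (_∷_ to _◂_)
open import Data.List as List using (List; []; _∷_; _++_; length)
open import Data.Product using (Σ; ∃; _×_; _,_; proj₁; proj₂)
open import Data.Sum using (_⊎_; inj₁; inj₂)
import Data.Sum.Properties as Sum
open import Data.Unit using (tt)
open import Function using (_∘_; id)
open import Function.Bundles using (_⇔_; mk⇔)
open import Function.Definitions using (Bijective)
open import Relation.Nullary using (¬_; Dec; yes; no; contradiction; ¬?)
open import Relation.Nullary.Decidable using (decidable-stable)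
open import Relation.Unary using () renaming (Decidable to Decidable₁)
open import Relation.Binary.Core using (Rel)
open import Relation.Binary.Definitions using (Decidable; Tri; tri<; tri≈; tri>)
open import Relation.Binary.Structures using (IsStrictTotalOrder)
open import Relation.Binary.PropositionalEquality hiding (subst; [_])
import Relation.Binary.PropositionalEquality as ≡

-- Parameter words

-- Two words of the final cube are joined by a chain of words most of which lie outside that cube,
-- because copies of one coordinate receive different letters on the way; the repetition of
-- coordinates makes room for this. A link may change many positions, but the pairs (old letter, new
-- letter) at the changed positions are of at most two kinds. So its ends are two values of one
-- parameter word with at most two parameters, which is why no larger number of parameters has to be
-- coloured. Whichever parameter occurs first is part of the link, and this is how the index of a
-- coordinate enters the order.

infixr 5 _▹_
infix 5 ✶_

-- Canonical parameter words: the d parameters are numbered by first occurrence, and after its first occurrence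
-- a parameter is one more letter of the alphabet (with index zero).
data PW : ℕ → ℕ → ℕ → Set where
  ε   : ∀ {b} → PW b 0 0
  _▹_ : ∀ {b d n} → Fin b → PW b d n → PW b d (suc n)
  ✶_  : ∀ {b d n} → PW (suc b) d n → PW b (suc d) (suc n)

-- Values in an arbitrary `A` cover both words and, with `inj₁` and `inj₂`, the parameter words of
-- the theorem.
eval : ∀ {A : Set} {b d n} → PW b d n → (Fin b → A) → (Fin d → A) → Vec A n
eval ε       σ τ = []
eval (x ▹ p) σ τ = σ x ∷ eval p σ τ
eval (✶ p)   σ τ = τ zero ∷ eval p (τ zero ◂ σ) (τ ∘ suc)

-- `ρ` records what the letters of the first word, including its parameters already met, have become
-- over the alphabet of the second.
compose : ∀ {a b d m n} → PW a d n → (Fin a → Fin b) → PW b m d → PW b m n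
compose ε       ρ ε       = ε
compose (x ▹ p) ρ q       = ρ x ▹ compose p ρ q
compose (✶ p)   ρ (y ▹ q) = y ▹ compose p (y ◂ ρ) q
compose (✶ p)   ρ (✶ q)   = ✶ compose p (zero ◂ suc ∘ ρ) q

infixr 6 _⊙_
_⊙_ : ∀ {b d m n} → PW b d n → PW b m d → PW b m n
p ⊙ q = compose p id q

lift : ∀ {a b} → (Fin a → Fin b) → Fin (suc a) → Fin (suc b)
lift ρ = zero ◂ suc ∘ ρ

rename : ∀ {a b d n} → (Fin a → Fin b) → PW a d n → PW b d n
rename ρ ε       = ε
rename ρ (x ▹ p) = ρ x ▹ rename ρ p
rename ρ (✶ p)   = ✶ rename (lift ρ) p

append : ∀ {a b d e m n} → PW a d m → (Fin b → Fin a) → PW b e n → PW a (d + e) (m + n)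
append ε       ρ q = rename ρ q
append (x ▹ p) ρ q = x ▹ append p ρ q
append (✶ p)   ρ q = ✶ append p (suc ∘ ρ) q

identity : ∀ {b d} → PW b d d
identity {d = zero}  = ε
identity {d = suc d} = ✶ identity

prefix : ∀ {b d n} → PW b d n → List (Fin b)
prefix ε       = []
prefix (x ▹ p) = x ∷ prefix p
prefix (✶ p)   = []

◂-cong : ∀ {A : Set} {n} (x : A) {f g : Fin n → A} → f ≗ g → (x ◂ f) ≗ (x ◂ g)
◂-cong x f≗g zero    = refl
◂-cong x f≗g (suc i) = f≗g i

∘-◂ : ∀ {A B : Set} {n} (f : A → B) (x : A) (g : Fin n → A) → f ∘ (x ◂ g) ≗ (f x ◂ f ∘ g)
∘-◂ f x g zero    = refl
∘-◂ f x g (suc i) = refl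

eval-cong : ∀ {A : Set} {b d n} (p : PW b d n) {σ σ′ : Fin b → A} {τ τ′ : Fin d → A} →
            σ ≗ σ′ → τ ≗ τ′ → eval p σ τ ≡ eval p σ′ τ′
eval-cong ε       e f = refl
eval-cong (x ▹ p) e f = cong₂ _∷_ (e x) (eval-cong p e f)
eval-cong (✶ p) {σ′ = σ′} {τ} e f = cong₂ _∷_ (f zero) (eval-cong p e′ (f ∘ suc))
  where
  e′ : (τ zero ◂ _) ≗ (_ ◂ σ′)
  e′ zero    = f zero
  e′ (suc i) = e i

eval-map : ∀ {A B : Set} (f : A → B) {b d n} (p : PW b d n) {σ : Fin b → A} {τ : Fin d → A} →
           Vec.map f (eval p σ τ) ≡ eval p (f ∘ σ) (f ∘ τ)
eval-map f ε       = refl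
eval-map f (x ▹ p) = cong (_ ∷_) (eval-map f p)
eval-map f (✶ p) {σ} {τ} = cong (_ ∷_) (trans (eval-map f p) (eval-cong p (∘-◂ f (τ zero) σ) λ _ → refl))

eval-rename : ∀ {A : Set} {a b d n} (p : PW a d n) (ρ : Fin a → Fin b) {σ : Fin b → A} {τ : Fin d → A} →
              eval (rename ρ p) σ τ ≡ eval p (σ ∘ ρ) τ
eval-rename ε       ρ = refl
eval-rename (x ▹ p) ρ = cong (_ ∷_) (eval-rename p ρ)
eval-rename (✶ p)   ρ {σ} {τ} = cong (_ ∷_) (trans (eval-rename p (lift ρ)) (eval-cong p e λ _ → refl))
  where
  e : (τ zero ◂ σ) ∘ lift ρ ≗ (τ zero ◂ σ ∘ ρ)
  e zero    = refl
  e (suc i) = refl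

eval-compose : ∀ {A : Set} {a b d m n} (p : PW a d n) (ρ : Fin a → Fin b) (q : PW b m d)
               {σ : Fin b → A} {τ : Fin m → A} →
               eval (compose p ρ q) σ τ ≡ eval p (σ ∘ ρ) (lookup (eval q σ τ))
eval-compose ε       ρ ε       = refl
eval-compose (x ▹ p) ρ q       = cong (_ ∷_) (eval-compose p ρ q)
eval-compose (✶ p)   ρ (y ▹ q) {σ} = cong (_ ∷_)
  (trans (eval-compose p (y ◂ ρ) q) (eval-cong p (∘-◂ σ y ρ) λ _ → refl))
eval-compose (✶ p)   ρ (✶ q)   {σ} {τ} = cong (_ ∷_)
  (trans (eval-compose p (lift ρ) q) (eval-cong p e λ _ → refl))
  where
  e : (τ zero ◂ σ) ∘ lift ρ ≗ (τ zero ◂ σ ∘ ρ)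
  e zero    = refl
  e (suc i) = refl

compose-cong : ∀ {a b d m n} (p : PW a d n) {ρ ρ′ : Fin a → Fin b} → ρ ≗ ρ′ → (q : PW b m d) →
               compose p ρ q ≡ compose p ρ′ q
compose-cong ε       e ε       = refl
compose-cong (x ▹ p) e q       = cong₂ _▹_ (e x) (compose-cong p e q)
compose-cong (✶ p)   e (y ▹ q) = cong (y ▹_) (compose-cong p (◂-cong y e) q)
compose-cong (✶ p)   e (✶ q)   = cong ✶_ (compose-cong p (◂-cong zero (cong suc ∘ e)) q)

compose-assoc : ∀ {a b c d e m n} (p : PW a d n) (ρ : Fin a → Fin b) (q : PW b e d) (σ : Fin b → Fin c)
                (r : PW c m e) →
                compose (compose p ρ q) σ r ≡ compose p (σ ∘ ρ) (compose q σ r)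
compose-assoc ε       ρ ε       σ ε = refl
compose-assoc (x ▹ p) ρ q       σ r = cong (_ ▹_) (compose-assoc p ρ q σ r)
compose-assoc (✶ p)   ρ (y ▹ q) σ r = cong (_ ▹_)
  (trans (compose-assoc p (y ◂ ρ) q σ r) (compose-cong p (∘-◂ σ y ρ) _))
compose-assoc (✶ p)   ρ (✶ q)   σ (z ▹ r) = cong (_ ▹_)
  (trans (compose-assoc p (lift ρ) q (z ◂ σ) r) (compose-cong p (λ { zero → refl ; (suc _) → refl }) _))
compose-assoc (✶ p)   ρ (✶ q)   σ (✶ r) = cong ✶_
  (trans (compose-assoc p (lift ρ) q (lift σ) r) (compose-cong p (λ { zero → refl ; (suc _) → refl }) _))

compose-rename : ∀ {a b c d m n} (p : PW a d n) (f : Fin a → Fin b) (ρ : Fin b → Fin c) (q : PW c m d) →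
                 compose (rename f p) ρ q ≡ compose p (ρ ∘ f) q
compose-rename ε       f ρ ε       = refl
compose-rename (x ▹ p) f ρ q       = cong (_ ▹_) (compose-rename p f ρ q)
compose-rename (✶ p)   f ρ (y ▹ q) = cong (_ ▹_)
  (trans (compose-rename p (lift f) (y ◂ ρ) q) (compose-cong p (λ { zero → refl ; (suc _) → refl }) q))
compose-rename (✶ p)   f ρ (✶ q)   = cong ✶_
  (trans (compose-rename p (lift f) (lift ρ) q) (compose-cong p (λ { zero → refl ; (suc _) → refl }) q))

eval-append : ∀ {A : Set} {a b d e m n} (p : PW a d m) (ρ : Fin b → Fin a) (q : PW b e n)
              {σ : Fin a → A} {τ : Fin (d + e) → A} →
              eval (append p ρ q) σ τ ≡ eval p σ (τ ∘ (Fin._↑ˡ e)) Vec.++ eval q (σ ∘ ρ) (τ ∘ (d Fin.↑ʳ_))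
eval-append ε       ρ q = eval-rename q ρ
eval-append (x ▹ p) ρ q = cong (_ ∷_) (eval-append p ρ q)
eval-append (✶ p)   ρ q = cong (_ ∷_) (eval-append p (suc ∘ ρ) q)

-- The Hales-Jewett theorem

funToFin-injective : ∀ {m n} (f g : Fin m → Fin n) → funToFin f ≡ funToFin g → f ≗ g
funToFin-injective f g e x =
  trans (sym (Fin.finToFun-funToFin f x)) (trans (cong (λ z → finToFun z x) e) (Fin.finToFun-funToFin g x))

-- Pigeonhole needs colours in some `Fin R`; this makes such a colour out of a whole colouring
-- restricted to short words. Colourings live on lists because prefixes have varying lengths.
restrictions : ∀ b r n → Σ ℕ λ R → Σ ((List (Fin b) → Fin r) → Fin R) λ code →
               ∀ f g → code f ≡ code g → ∀ v → length v ≤ n → f v ≡ g v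
restrictions b r zero = r , (λ f → f []) , λ { f g e [] _ → e }
restrictions b r (suc n) with restrictions b r n
... | R , code , inj = r * R ^ b , code′ , inj′
  where
  code′ : (List (Fin b) → Fin r) → Fin (r * R ^ b)
  code′ f = combine (f []) (funToFin (λ x → code (f ∘ (x ∷_))))
  inj′ : ∀ f g → code′ f ≡ code′ g → ∀ v → length v ≤ suc n → f v ≡ g v
  inj′ f g e v v≤ with Fin.combine-injective (f []) _ (g []) _ e
  inj′ f g e []      _        | e₁ , _  = e₁
  inj′ f g e (x ∷ v) (s≤s v≤) | _  , e₂ = inj _ _ (funToFin-injective _ _ e₂ x) v v≤

-- The words 0^j 1^(N-j) of Shelah's proof: any two of them span a line, and by pigeonhole two have equal colour.
step : ∀ {b} N → Fin (suc N) → Vec (Fin (2 + b)) N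
step zero    _       = []
step (suc N) zero    = suc zero ∷ step N zero
step (suc N) (suc j) = zero ∷ step N j

step-line : ∀ {b} N {i j : Fin (suc N)} → i Fin.< j →
            Σ (PW (2 + b) 1 N) λ ℓ → (∀ τ → τ zero ≡ zero → eval ℓ id τ ≡ step N j) ×
                                     (∀ τ → τ zero ≡ suc zero → eval ℓ id τ ≡ step N i)
step-line {b} (suc N) {zero} {suc j} _ =
  ✶ tail N j , (λ τ e → cong₂ _∷_ e (tail₀ N j _ e)) , λ τ e → cong₂ _∷_ e (tail₁ N j _ e)
  where
  tail : ∀ N → Fin (suc N) → PW (3 + b) 0 N
  tail zero    _       = ε
  -- In the alphabet enlarged by the parameter, `zero` is that parameter and `suc (suc zero)` the
  -- letter one.
  tail (suc N) zero    = suc (suc zero) ▹ tail N zero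
  tail (suc N) (suc j) = zero ▹ tail N j
  tail₀ : ∀ N j {x} (τ : Fin 0 → _) → x ≡ zero → eval (tail N j) (x ◂ id) τ ≡ step N j
  tail₀ zero    _       τ e = refl
  tail₀ (suc N) zero    τ e = cong (_ ∷_) (tail₀ N zero τ e)
  tail₀ (suc N) (suc j) τ e = cong₂ _∷_ e (tail₀ N j τ e)
  tail₁ : ∀ N j {x} (τ : Fin 0 → _) → x ≡ suc zero → eval (tail N j) (x ◂ id) τ ≡ step N zero
  tail₁ zero    _       τ e = refl
  tail₁ (suc N) zero    τ e = cong (_ ∷_) (tail₁ N zero τ e)
  tail₁ (suc N) (suc j) τ e = cong₂ _∷_ e (tail₁ N j τ e)
step-line (suc N) {suc i} {suc j} (s≤s i<j) with step-line N i<j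
... | ℓ , ℓ₀ , ℓ₁ = zero ▹ ℓ , (λ τ e → cong (zero ∷_) (ℓ₀ τ e)) , λ τ e → cong (zero ∷_) (ℓ₁ τ e)

merge : ∀ {b} → Fin (2 + b) → Fin (1 + b)
merge zero    = zero
merge (suc x) = x

-- `suc ∘ merge` turns zeros into ones. Coordinates are added in front: two step words with equal
-- colours under all continuations of length `n` span the new line, and the rest of the cube is
-- found for the colouring that records the results of all values of the new parameter at once.
merge-invariant-cube : ∀ b D r → ∃ λ n → (f : List (Fin (2 + b)) → Fin r) → Σ (PW (2 + b) D n) λ p →
                       ∀ τ → f (toList (eval p id τ)) ≡ f (toList (eval p id (suc ∘ merge ∘ τ)))
merge-invariant-cube b zero    r = 0 , λ f → ε , λ τ → refl
merge-invariant-cube b (suc D) r with merge-invariant-cube b D (r ^ (2 + b))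
... | n , ih with restrictions (2 + b) r n
... | N , code , inj = N + n , cube
  where
  cube : (f : List (Fin (2 + b)) → Fin r) → Σ (PW (2 + b) (suc D) (N + n)) λ p →
         ∀ τ → f (toList (eval p id τ)) ≡ f (toList (eval p id (suc ∘ merge ∘ τ)))
  -- `N` is the number of codes, and there are `N + 1` step words.
  cube f with Fin.pigeonhole (ℕ.n<1+n N) (λ j → code (λ v → f (toList (step N j) ++ v)))
  ... | i , j , i<j , same with step-line {b} N i<j
  ... | ℓ , ℓ₀ , ℓ₁ with ih (λ v → funToFin (λ a → f (toList (eval ℓ id (λ _ → a)) ++ v)))
  ... | p , inv = append ℓ id p , λ τ → begin
      f (toList (eval (append ℓ id p) id τ))
        ≡⟨ cong f (split τ) ⟩
      f (first (τ zero) ++ toList (eval p id (τ ∘ suc)))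
        ≡⟨ funToFin-injective (values (τ ∘ suc)) (values (suc ∘ merge ∘ τ ∘ suc)) (inv (τ ∘ suc)) (τ zero) ⟩
      f (first (τ zero) ++ toList (eval p id (suc ∘ merge ∘ τ ∘ suc)))
        ≡⟨ swap (τ zero) (eval p id _) ⟩
      f (first (suc (merge (τ zero))) ++ toList (eval p id (suc ∘ merge ∘ τ ∘ suc)))
        ≡⟨ cong f (split _) ⟨
      f (toList (eval (append ℓ id p) id (suc ∘ merge ∘ τ))) ∎
    where
    open ≡-Reasoning
    first : Fin (2 + b) → List (Fin (2 + b))
    first a = toList (eval ℓ id (λ _ → a))
    values : (Fin D → Fin (2 + b)) → Fin (2 + b) → Fin r
    values τ a = f (first a ++ toList (eval p id τ))
    split : ∀ τ → toList (eval (append ℓ id p) id τ) ≡ first (τ zero) ++ toList (eval p id (τ ∘ suc))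
    split τ = trans (trans (cong toList (eval-append ℓ id p)) (Vec.toList-++ (eval ℓ id _) _))
      (cong (λ v → toList v ++ toList (eval p id (τ ∘ suc)))
        (eval-cong ℓ (λ _ → refl) (λ { zero → refl })))
    swap : ∀ a (v : Vec _ n) → f (first a ++ toList v) ≡ f (first (suc (merge a)) ++ toList v)
    swap zero    v rewrite ℓ₀ (λ _ → zero) refl | ℓ₁ (λ _ → suc zero) refl =
      sym (inj _ _ same (toList v) (ℕ.≤-reflexive (Vec.length-toList v)))
    swap (suc a) v = refl

pad : ∀ {b} n → List (Fin (suc b)) → Fin n → Fin (suc b)
pad (suc n) []      _       = zero
pad (suc n) (x ∷ v) zero    = x
pad (suc n) (x ∷ v) (suc i) = pad n v i

pad-toList : ∀ {b n} (v : Vec (Fin (suc b)) n) → pad n (toList v) ≗ lookup v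
pad-toList (x ∷ v) zero    = refl
pad-toList (x ∷ v) (suc i) = pad-toList v i

-- Induction on the alphabet: once colours do not notice zeros turning into ones, only the words
-- without the letter zero matter, and these use one letter fewer.
hales-jewett : ∀ b d r → ∃ λ n → (f : List (Fin (suc b)) → Fin r) → Σ (PW (suc b) d n) λ p →
               Σ (Fin r) λ c → ∀ τ → f (toList (eval p id τ)) ≡ c
hales-jewett zero    d r = d , λ f → identity , _ , λ τ →
  cong (f ∘ toList) (eval-cong identity (λ _ → refl) λ i → unique (τ i))
  where
  unique : (x : Fin 1) → x ≡ zero
  unique zero = refl
hales-jewett (suc b) d r with hales-jewett b d r
... | D , ih with merge-invariant-cube b D r
... | n , cube = n , line
  where
  line : (f : List (Fin (2 + b)) → Fin r) → Σ (PW (2 + b) d n) λ p →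
         Σ (Fin r) λ c → ∀ τ → f (toList (eval p id τ)) ≡ c
  line f with cube f
  ... | p , inv with ih (λ u → f (toList (eval p id (suc ∘ pad D u))))
  ... | q , c , mono = p ⊙ rename suc q , c , λ τ → begin
      f (toList (eval (p ⊙ rename suc q) id τ))
        ≡⟨ cong (f ∘ toList) (eval-compose p id (rename suc q)) ⟩
      f (toList (eval p id (lookup (eval (rename suc q) id τ))))
        ≡⟨ inv _ ⟩
      f (toList (eval p id (suc ∘ merge ∘ lookup (eval (rename suc q) id τ))))
        ≡⟨ cong (f ∘ toList) (eval-cong p (λ _ → refl) λ i → cong suc (merged τ i)) ⟩
      f (toList (eval p id (suc ∘ pad D (toList (eval q id (merge ∘ τ))))))
        ≡⟨ mono (merge ∘ τ) ⟩
      c ∎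
    where
    open ≡-Reasoning
    merged : ∀ τ → merge ∘ lookup (eval (rename suc q) id τ) ≗ pad D (toList (eval q id (merge ∘ τ)))
    merged τ i = begin
      merge (lookup (eval (rename suc q) id τ) i)    ≡⟨ cong (λ v → merge (lookup v i)) (eval-rename q suc) ⟩
      merge (lookup (eval q suc τ) i)                ≡⟨ Vec.lookup-map i merge (eval q suc τ) ⟨
      lookup (Vec.map merge (eval q suc τ)) i        ≡⟨ cong (λ v → lookup v i) (eval-map merge q) ⟩
      lookup (eval q id (merge ∘ τ)) i               ≡⟨ pad-toList (eval q id (merge ∘ τ)) i ⟨
      pad D (toList (eval q id (merge ∘ τ))) i       ∎

-- The Graham-Rothschild theorem

length-prefix : ∀ {b d n} (p : PW b d n) → length (prefix p) ≤ n
length-prefix ε       = z≤n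
length-prefix (x ▹ p) = s≤s (length-prefix p)
length-prefix (✶ p)   = z≤n

prefix-append-word : ∀ {a b c d e m n} (u : PW a 0 m) (ρ : Fin b → Fin a) (p : PW b d n) (σ : Fin a → Fin c)
                     (q : PW c e d) τ →
                     prefix (compose (append u ρ p) σ q) ≡ toList (eval u σ τ) ++ prefix (compose p (σ ∘ ρ) q)
prefix-append-word ε       ρ p σ q τ = cong prefix (compose-rename p ρ σ q)
prefix-append-word (x ▹ u) ρ p σ q τ = cong (_ ∷_) (prefix-append-word u ρ p σ q τ)

prefix-append-▹ : ∀ {a b c d e m n} (ℓ : PW a 1 m) (ρ : Fin b → Fin a) (p : PW b d n) (σ : Fin a → Fin c)
                  (y : Fin c) (q : PW c e d) →
                  prefix (compose (append ℓ ρ p) σ (y ▹ q)) ≡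
                  toList (eval ℓ σ (λ _ → y)) ++ prefix (compose p (σ ∘ ρ) q)
prefix-append-▹ (x ▹ ℓ) ρ p σ y q = cong (_ ∷_) (prefix-append-▹ ℓ ρ p σ y q)
prefix-append-▹ (✶ u)   ρ p σ y q = cong (y ∷_) (prefix-append-word u (suc ∘ ρ) p (y ◂ σ) q _)

prefix-append-✶ : ∀ {a b c d e m n} (ℓ : PW a 1 m) (ρ : Fin b → Fin a) (p : PW b d n) (σ : Fin a → Fin c)
                  (q : PW (suc c) e d) →
                  prefix (compose (append ℓ ρ p) σ (✶ q)) ≡ List.map σ (prefix ℓ)
prefix-append-✶ (x ▹ ℓ) ρ p σ q = cong (_ ∷_) (prefix-append-✶ ℓ ρ p σ q)
prefix-append-✶ (✶ u)   ρ p σ q = refl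

-- Each coordinate becomes a line whose letter does not affect the colour under any continuation, so
-- the letters of `q` before its first parameter can all be taken to be `zero`. That parameter
-- itself cuts the prefix off inside its line.
prefix-length-cube : ∀ b D r → ∃ λ n → (f : List (Fin (suc b)) → Fin r) → Σ (PW (suc b) D n) λ p →
                     Σ (ℕ → Fin r) λ g → ∀ {m} (q : PW (suc b) (suc m) D) →
                     f (prefix (p ⊙ q)) ≡ g (length (prefix q))
prefix-length-cube b zero    r = 0 , λ f → ε , (λ _ → f []) , λ ()
prefix-length-cube b (suc D) r with prefix-length-cube b D r
... | n , ih with restrictions (suc b) r n
... | R , code , inj with hales-jewett b 1 R
... | N , hj = N + n , cube
  where
  cube : (f : List (Fin (suc b)) → Fin r) → Σ (PW (suc b) (suc D) (N + n)) λ p →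
         Σ (ℕ → Fin r) λ g → ∀ {m} (q : PW (suc b) (suc m) (suc D)) →
         f (prefix (p ⊙ q)) ≡ g (length (prefix q))
  cube f with hj (λ u → code (λ v → f (u ++ v)))
  ... | ℓ , c , mono with ih (λ v → f (toList (eval ℓ id (λ _ → zero)) ++ v))
  ... | p , g , tail = append ℓ id p , g′ , correct
    where
    g′ : ℕ → Fin r
    g′ zero    = f (List.map id (prefix ℓ))
    g′ (suc i) = g i
    correct : ∀ {m} (q : PW (suc b) (suc m) (suc D)) → f (prefix (append ℓ id p ⊙ q)) ≡ g′ (length (prefix q))
    correct (✶ q)   = cong f (prefix-append-✶ ℓ id p id q)
    correct (y ▹ q) = begin
      f (prefix (append ℓ id p ⊙ (y ▹ q)))
        ≡⟨ cong f (prefix-append-▹ ℓ id p id y q) ⟩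
      f (toList (eval ℓ id (λ _ → y)) ++ prefix (p ⊙ q))
        ≡⟨ inj _ _ (trans (mono _) (sym (mono _))) (prefix (p ⊙ q)) (length-prefix (p ⊙ q)) ⟩
      f (toList (eval ℓ id (λ _ → zero)) ++ prefix (p ⊙ q))
        ≡⟨ tail q ⟩
      g (length (prefix q)) ∎
      where open ≡-Reasoning

Selects : ∀ b {r} → ℕ → ℕ → (ℕ → Fin r) → Fin r → Set
Selects b e D g c = Σ (PW (suc b) e D) λ p → ∀ {m} (q : PW (suc b) (suc m) e) → g (length (prefix (p ⊙ q))) ≡ c

selects-none : ∀ {b r} D (g : ℕ → Fin r) {c} → Selects b 0 D g c
selects-none zero    g     = ε , λ ()
selects-none (suc D) g {c} = zero ▹ proj₁ (selects-none D g {c}) , λ ()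

-- If the new coordinate stays a parameter, the prefix has length 0; if it receives a letter, all
-- lengths grow by 1. `rename suc` keeps the old cube from using the new parameter.
selects-✶ : ∀ {b r e D} (g : ℕ → Fin r) {c} → g 0 ≡ c → Selects b e D (g ∘ suc) c → Selects b (suc e) (suc D) g c
selects-✶ {b} {e = e} {D} g {c} g₀ (p , h) = ✶ rename suc p , correct
  where
  correct : ∀ {m} (q : PW (suc b) (suc m) (suc e)) → g (length (prefix ((✶ rename suc p) ⊙ q))) ≡ c
  correct (✶ q)   = g₀
  correct (y ▹ q) = trans (cong (g ∘ suc ∘ length ∘ prefix) (compose-rename p suc (y ◂ id) q)) (h q)

sum-[]≔ : ∀ {r} (v : Vec ℕ r) i {k} → lookup v i ≡ suc k → Vec.sum v ≡ suc (Vec.sum (v [ i ]≔ k))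
sum-[]≔ (x ∷ v) zero    e = cong (_+ Vec.sum v) e
sum-[]≔ (x ∷ v) (suc i) e = trans (cong (x +_) (sum-[]≔ v i e)) (ℕ.+-suc x _)

-- The entry of v at a colour says how many positions of that colour are still wanted.
select : ∀ b {r} (g : ℕ → Fin r) (v : Vec ℕ r) D → Vec.sum v ≡ D → ∃ λ c → Selects b (lookup v c) D g c
select b g v D sum-v with lookup v (g 0) in e
-- Nothing more is wanted in this colour, so dimension 0 will do. As the entries sum to the number
-- of positions left, this happens at the latest when none is left.
select b g v D sum-v | zero = g 0 , ≡.subst (λ e → Selects b e D g (g 0)) (sym e) (selects-none D g)
select b g v zero sum-v | suc k with () ← trans (sym sum-v) (sum-[]≔ v (g 0) e)
select b g v (suc D) sum-v | suc k
  with select b (g ∘ suc) (v [ g 0 ]≔ k) D (ℕ.suc-injective (trans (sym (sum-[]≔ v (g 0) e)) sum-v))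
... | c , s with c Fin.≟ g 0
... | yes refl = c , ≡.subst (λ e → Selects b e (suc D) g c) (sym e)
                   (selects-✶ g refl (≡.subst (λ e → Selects b e D (g ∘ suc) c) (Vec.lookup∘update c v k) s))
... | no c≢    = c , extend (≡.subst (λ e → Selects b e D (g ∘ suc) c) (Vec.lookup∘update′ c≢ v k) s)
  where
  extend : ∀ {e} → Selects b e D (g ∘ suc) c → Selects b e (suc D) g c
  extend (p , h) = zero ▹ p , h

word : ∀ {b n} → (Fin n → Fin b) → PW b 0 n
word {n = zero}  f = ε
word {n = suc n} f = f zero ▹ word (f ∘ suc)

word-cong : ∀ {b n} {f g : Fin n → Fin b} → f ≗ g → word f ≡ word g
word-cong {n = zero}  e = refl
word-cong {n = suc n} e = cong₂ _▹_ (e zero) (word-cong (e ∘ suc))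

word-eval : ∀ {b n} (q : PW b 0 n) τ → word (lookup (eval q id τ)) ≡ q
word-eval ε       τ = refl
word-eval (x ▹ q) τ = cong (x ▹_) (word-eval q τ)

-- The argument `Fin r` is a default colour for the case that `d` is less than `m` and there is no
-- `q`.
Graham-Rothschild : ℕ → Set
Graham-Rothschild m = ∀ b d r → ∃ λ n → Fin r → (c : PW (suc b) m n → Fin r) →
                      Σ (PW (suc b) d n) λ p → Σ (Fin r) λ k → ∀ q → c (p ⊙ q) ≡ k

-- After a leading parameter there remain `m` parameters over one more letter, so the theorem for
-- `m` gives all words with empty prefix one colour. Words with a leading letter are left to the
-- recursion on `D`.
prefix-cube : ∀ {m} → Graham-Rothschild m → ∀ b D r → ∃ λ n → Fin r → (c : PW (suc b) (suc m) n → Fin r) →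
              Σ (PW (suc b) D n) λ p → Σ (List (Fin (suc b)) → Fin r) λ f → ∀ q → c (p ⊙ q) ≡ f (prefix q)
prefix-cube gr b zero    r = 0 , λ x c → ε , (λ _ → x) , λ ()
prefix-cube {m} gr b (suc D) r with prefix-cube gr b D (r ^ suc b)
... | D₁ , ih with gr (suc b) D₁ r
... | n , homogeneous = suc n , cube
  where
  cube : Fin r → (c : PW (suc b) (suc m) (suc n) → Fin r) →
         Σ (PW (suc b) (suc D) (suc n)) λ p → Σ (List (Fin (suc b)) → Fin r) λ f → ∀ q → c (p ⊙ q) ≡ f (prefix q)
  cube x c with homogeneous x (c ∘ ✶_)
  -- All leading letters `y` are treated at once; `y ◂ id` reads the letter that stood for the
  -- leading parameter as `y`.
  ... | p , k , mono with ih (funToFin {suc b} (λ _ → x)) (λ z → funToFin (λ y → c (y ▹ compose p (y ◂ id) z)))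
  ... | p′ , f , tail = (✶ (p ⊙ rename suc p′)) , f′ , correct
    where
    f′ : List (Fin (suc b)) → Fin r
    f′ []      = k
    f′ (y ∷ u) = finToFun (f u) y
    correct : ∀ q → c ((✶ (p ⊙ rename suc p′)) ⊙ q) ≡ f′ (prefix q)
    correct (✶ q)   = trans (cong (c ∘ ✶_) (trans (compose-assoc p id (rename suc p′) (zero ◂ suc) q)
                        (compose-cong p (λ { zero → refl ; (suc _) → refl }) _))) (mono _)
    correct (y ▹ q) = begin
      c (y ▹ compose (p ⊙ rename suc p′) (y ◂ id) q)
        ≡⟨ cong (c ∘ (y ▹_)) (compose-assoc p id (rename suc p′) (y ◂ id) q) ⟩
      c (y ▹ compose p (y ◂ id) (compose (rename suc p′) (y ◂ id) q))
        ≡⟨ cong (c ∘ (y ▹_) ∘ compose p (y ◂ id)) (compose-rename p′ suc (y ◂ id) q) ⟩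
      c (y ▹ compose p (y ◂ id) (p′ ⊙ q))
        ≡⟨ Fin.finToFun-funToFin (λ y → c (y ▹ compose p (y ◂ id) (p′ ⊙ q))) y ⟨
      finToFun (funToFin (λ y → c (y ▹ compose p (y ◂ id) (p′ ⊙ q)))) y
        ≡⟨ cong (λ z → finToFun z y) (tail q) ⟩
      finToFun (f (prefix q)) y ∎
      where open ≡-Reasoning

-- The colour is made to depend on the prefix only, then on its length only. Among `r * d`
-- coordinates, `select` then finds `d` whose prefix lengths share a colour.
graham-rothschild : ∀ m → Graham-Rothschild m
graham-rothschild zero b d r with hales-jewett b d r
... | n , hj = n , cube
  where
  cube : Fin r → (c : PW (suc b) 0 n → Fin r) → Σ (PW (suc b) d n) λ p → Σ (Fin r) λ k → ∀ q → c (p ⊙ q) ≡ k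
  cube _ c with hj (c ∘ word ∘ pad n)
  ... | p , k , mono = p , k , λ q → trans (cong c (sym (as-word q))) (mono (lookup (eval q id λ ())))
    where
    as-word : ∀ q → word (pad n (toList (eval p id (lookup (eval q id λ ()))))) ≡ p ⊙ q
    as-word q = trans (word-cong (pad-toList _))
      (trans (cong (word ∘ lookup) (sym (eval-compose p id q))) (word-eval (p ⊙ q) _))
graham-rothschild (suc m) b d r with prefix-length-cube b (Vec.sum (Vec.replicate r d)) r
... | D₂ , lengths with prefix-cube (graham-rothschild m) b D₂ r
... | n , prefixes = n , cube
  where
  cube : Fin r → (c : PW (suc b) (suc m) n → Fin r) → Σ (PW (suc b) d n) λ p → Σ (Fin r) λ k → ∀ q → c (p ⊙ q) ≡ k
  cube x c with prefixes x c
  ... | p₁ , f , h₁ with lengths f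
  ... | p₂ , g , h₂ with select b g (Vec.replicate r d) _ refl
  ... | k , s with ≡.subst (λ e → Selects b e (Vec.sum (Vec.replicate r d)) g k) (Vec.lookup-replicate k d) s
  ... | p₃ , h₃ = p₁ ⊙ p₂ ⊙ p₃ , k , λ q → begin
      c ((p₁ ⊙ p₂ ⊙ p₃) ⊙ q)              ≡⟨ cong c (compose-assoc p₁ id (p₂ ⊙ p₃) id q) ⟩
      c (p₁ ⊙ ((p₂ ⊙ p₃) ⊙ q))            ≡⟨ h₁ _ ⟩
      f (prefix ((p₂ ⊙ p₃) ⊙ q))          ≡⟨ cong (f ∘ prefix) (compose-assoc p₂ id p₃ id q) ⟩
      f (prefix (p₂ ⊙ (p₃ ⊙ q)))          ≡⟨ h₂ (p₃ ⊙ q) ⟩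
      g (length (prefix (p₃ ⊙ q)))        ≡⟨ h₃ q ⟩
      k                                   ∎
      where open ≡-Reasoning

-- Homogeneous cubes

infix 25 _⟨_⟩
_⟨_⟩ : ∀ {b d n} → PW b d n → (Fin d → Fin b) → Word b n
p ⟨ τ ⟩ = eval p id τ

⟨⟩-⊙ : ∀ {b d m n} (p : PW b d n) (q : PW b m d) τ → (p ⊙ q) ⟨ τ ⟩ ≡ p ⟨ lookup (q ⟨ τ ⟩) ⟩
⟨⟩-⊙ p q τ = eval-compose p id q

occurrence : ∀ {b d n} (p : PW b d n) (i : Fin d) → ∃ λ (m : Fin n) → ∀ {A : Set} (σ : Fin b → A) τ →
             lookup (eval p σ τ) m ≡ τ i
occurrence (x ▹ p) i with occurrence p i
... | m , h = suc m , λ σ τ → h σ τ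
occurrence (✶ p) zero    = zero , λ σ τ → refl
occurrence (✶ p) (suc i) with occurrence p i
... | m , h = suc m , λ σ τ → h _ (τ ∘ suc)

⟨⟩-injective : ∀ {b d n} (p : PW b d n) {τ τ′} → p ⟨ τ ⟩ ≡ p ⟨ τ′ ⟩ → τ ≗ τ′
⟨⟩-injective p {τ} {τ′} e i with occurrence p i
... | m , h = trans (sym (h id τ)) (trans (cong (λ v → lookup v m) e) (h id τ′))

-- The hypotheses on `σ` and `τ` ensure that the value `τ j` can only come from parameter `j`, and
-- parameters are introduced in order. For `inj₁` and `inj₂` this yields canonicity.
earlier-occurrence : ∀ {A : Set} {b d n} (p : PW b d n) (σ : Fin b → A) (τ : Fin d → A) →
                     (∀ x i → σ x ≢ τ i) → (∀ i j → τ i ≡ τ j → i ≡ j) →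
                     ∀ i j m → i Fin.< j → lookup (eval p σ τ) m ≡ τ j →
                     ∃ λ m′ → m′ Fin.< m × lookup (eval p σ τ) m′ ≡ τ i
earlier-occurrence (x ▹ p) σ τ σ≢τ inj i j zero    i<j e = contradiction e (σ≢τ x j)
earlier-occurrence (x ▹ p) σ τ σ≢τ inj i j (suc m) i<j e with earlier-occurrence p σ τ σ≢τ inj i j m i<j e
... | m′ , m′<m , e′ = suc m′ , s≤s m′<m , e′
earlier-occurrence (✶ p)   σ τ σ≢τ inj i       (suc j) zero    i<j e with () ← inj _ _ e
earlier-occurrence (✶ p)   σ τ σ≢τ inj zero    (suc j) (suc m) i<j e = zero , s≤s z≤n , refl
earlier-occurrence (✶ p)   σ τ σ≢τ inj (suc i) (suc j) (suc m) (s≤s i<j) e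
  with earlier-occurrence p (τ zero ◂ σ) (τ ∘ suc)
         (λ { zero i e′ → contradiction (inj _ _ e′) λ () ; (suc x) i → σ≢τ x (suc i) })
         (λ i j e′ → Fin.suc-injective (inj _ _ e′)) i j m i<j e
... | m′ , m′<m , e′ = suc m′ , s≤s m′<m , e′

toPWord : ∀ {k d n} → PW k d n → PWord k d n
toPWord p = eval p inj₁ inj₂

toPWord-isParamWord : ∀ {k d n} (p : PW k d n) → IsParamWord (toPWord p)
toPWord-isParamWord p i with occurrence p i
... | m , h = m , h inj₁ inj₂

toPWord-canonical : ∀ {k d n} (p : PW k d n) → Canonical (toPWord p)
toPWord-canonical p i j m m′ i<j (_ , first) (at , _)
  with earlier-occurrence p inj₁ inj₂ (λ _ _ ()) (λ _ _ → Sum.inj₂-injective) i j m′ i<j at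
... | l , l<m′ , e with toℕ m ℕ.<? toℕ m′
... | yes m<m′ = m<m′
... | no m≮m′  = contradiction e (first l (ℕ.<-≤-trans l<m′ (ℕ.≮⇒≥ m≮m′)))

substitute-toPWord : ∀ {k d n} (p : PW k d n) (w : Word k d) → subst (toPWord p) w ≡ p ⟨ lookup w ⟩
substitute-toPWord p w = eval-map _ p

pull : ∀ {b d n} → PW b d n → Rel (Word b n) 0ℓ → Rel (Word b d) 0ℓ
pull p _≺_ w w′ = p ⟨ lookup w ⟩ ≺ p ⟨ lookup w′ ⟩

pull-isStrictTotalOrder : ∀ {b d n} (p : PW b d n) {_≺_ : Rel (Word b n) 0ℓ} →
                          IsStrictTotalOrder _≡_ _≺_ → IsStrictTotalOrder _≡_ (pull p _≺_)
pull-isStrictTotalOrder p {_≺_} sto = record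
  { isStrictPartialOrder = record
    { isEquivalence = isEquivalence
    ; irrefl = λ { refl → irrefl refl }
    ; trans = λ x y → O.trans x y
    ; <-resp-≈ = (λ { refl h → h }) , λ { refl h → h } }
  ; compare = cmp }
  where
  module O = IsStrictTotalOrder sto
  open O using (irrefl)
  cmp : ∀ w w′ → Tri (pull p _≺_ w w′) (w ≡ w′) (pull p _≺_ w′ w)
  cmp w w′ with O.compare (p ⟨ lookup w ⟩) (p ⟨ lookup w′ ⟩)
  ... | tri< h e g = tri< h (λ { refl → e refl }) g
  ... | tri> h e g = tri> h (λ { refl → e refl }) g
  ... | tri≈ h e g = tri≈ h (trans (sym (Vec.tabulate∘lookup w))
                      (trans (Vec.tabulate-cong (⟨⟩-injective p e)) (Vec.tabulate∘lookup w′))) g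

Homogeneous : ∀ {b n} → ℕ → Rel (Word b n) 0ℓ → Set
Homogeneous {b} {n} m _≺_ = ∀ (q q′ : PW b m n) τ τ′ → q ⟨ τ ⟩ ≺ q ⟨ τ′ ⟩ → q′ ⟨ τ ⟩ ≺ q′ ⟨ τ′ ⟩

pull-homogeneous : ∀ {b d n m} (p : PW b d n) {_≺_ : Rel (Word b n) 0ℓ} →
                   Homogeneous m _≺_ → Homogeneous m (pull p _≺_)
pull-homogeneous p {_≺_} hom q q′ τ τ′ h =
  ≡.subst₂ _≺_ (⟨⟩-⊙ p q′ τ) (⟨⟩-⊙ p q′ τ′)
    (hom (p ⊙ q) (p ⊙ q′) τ τ′ (≡.subst₂ _≺_ (sym (⟨⟩-⊙ p q τ)) (sym (⟨⟩-⊙ p q τ′)) h))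

bit : ∀ {P : Set} → Dec P → Fin 2
bit (yes _) = suc zero
bit (no  _) = zero

bit-transport : ∀ {P Q : Set} {P? : Dec P} {Q? : Dec Q} → bit P? ≡ bit Q? → P → Q
bit-transport {P? = yes _} {yes q} e p = q
bit-transport {P? = no ¬p} {_}     e p = contradiction p ¬p

abstract
  -- The colour of a parameter word is the table of all comparisons between its values: one bit for
  -- each pair of its `suc b ^ m` fillings.
  homogeneous-cube : ∀ m b d → ∃ λ n → (_≺_ : Rel (Word (suc b) n) 0ℓ) → Decidable _≺_ →
                     Σ (PW (suc b) d n) λ p → Homogeneous m (pull p _≺_)
  homogeneous-cube m b d with graham-rothschild m b d ((2 ^ (suc b ^ m)) ^ (suc b ^ m))
  ... | n , gr = n , cube
    where
    cube : (_≺_ : Rel (Word (suc b) n) 0ℓ) → Decidable _≺_ → Σ (PW (suc b) d n) λ p → Homogeneous m (pull p _≺_)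
    cube _≺_ _≺?_ = let (p , c , mono) = gr (funToFin {suc b ^ m} λ _ → funToFin {suc b ^ m} λ _ → zero) colour in p , hom p c mono
      where
      row : PW (suc b) m n → Fin (suc b ^ m) → Fin (suc b ^ m) → Fin 2
      row q x y = bit (q ⟨ finToFun x ⟩ ≺? q ⟨ finToFun y ⟩)
      colour : PW (suc b) m n → Fin ((2 ^ (suc b ^ m)) ^ (suc b ^ m))
      colour q = funToFin λ x → funToFin (row q x)
      hom : ∀ (p : PW (suc b) d n) c → (∀ q → colour (p ⊙ q) ≡ c) → Homogeneous m (pull p _≺_)
      hom p c mono q q′ τ τ′ h =
        ≡.subst₂ _≺_ (to q′ τ) (to q′ τ′)
          (bit-transport same-bit (≡.subst₂ _≺_ (sym (to q τ)) (sym (to q τ′)) h))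
        where
        same-bit : row (p ⊙ q) (funToFin τ) (funToFin τ′) ≡ row (p ⊙ q′) (funToFin τ) (funToFin τ′)
        same-bit = funToFin-injective (row (p ⊙ q) (funToFin τ)) (row (p ⊙ q′) (funToFin τ))
          (funToFin-injective (funToFin ∘ row (p ⊙ q)) (funToFin ∘ row (p ⊙ q′))
            (trans (mono q) (sym (mono q′))) (funToFin τ)) (funToFin τ′)
        to : ∀ (q : PW (suc b) m d) (τ : Fin m → Fin (suc b)) → (p ⊙ q) ⟨ finToFun (funToFin τ) ⟩ ≡ p ⟨ lookup (q ⟨ τ ⟩) ⟩
        to q τ = trans (eval-cong (p ⊙ q) (λ _ → refl) (Fin.finToFun-funToFin τ)) (⟨⟩-⊙ p q τ)

-- Counting

indicator : ∀ {P : Set} → Dec P → ℕ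
indicator (yes _) = 1
indicator (no  _) = 0

count : ∀ {n} {P : Fin n → Set} → Decidable₁ P → ℕ
count {zero}  P? = 0
count {suc n} P? = indicator (P? zero) + count (P? ∘ suc)

count-mono : ∀ {n} {P Q : Fin n → Set} (P? : Decidable₁ P) (Q? : Decidable₁ Q) →
             (∀ i → P i → Q i) → count P? ≤ count Q?
count-mono {zero}  P? Q? P⊆Q = z≤n
count-mono {suc n} P? Q? P⊆Q with P? zero | Q? zero | count-mono (P? ∘ suc) (Q? ∘ suc) (P⊆Q ∘ suc)
... | yes p | yes q | ih = s≤s ih
... | yes p | no ¬q | ih = contradiction (P⊆Q zero p) ¬q
... | no ¬p | yes q | ih = ℕ.m≤n⇒m≤1+n ih
... | no ¬p | no ¬q | ih = ih

count-strict : ∀ {n} {P Q : Fin n → Set} (P? : Decidable₁ P) (Q? : Decidable₁ Q) →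
               (∀ i → P i → Q i) → ∀ x → Q x → ¬ P x → count P? < count Q?
count-strict P? Q? P⊆Q zero q ¬p with P? zero | Q? zero
... | yes p | _     = contradiction p ¬p
... | no _  | no ¬q = contradiction q ¬q
... | no _  | yes _ = s≤s (count-mono (P? ∘ suc) (Q? ∘ suc) (P⊆Q ∘ suc))
count-strict P? Q? P⊆Q (suc x) q ¬p
  with P? zero | Q? zero | count-strict (P? ∘ suc) (Q? ∘ suc) (P⊆Q ∘ suc) x q ¬p
... | yes p | yes q | ih = s≤s ih
... | yes p | no ¬q | ih = contradiction (P⊆Q zero p) ¬q
... | no ¬p | yes q | ih = ℕ.m≤n⇒m≤1+n ih
... | no ¬p | no ¬q | ih = ih

count≤n : ∀ {n} {P : Fin n → Set} (P? : Decidable₁ P) → count P? ≤ n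
count≤n {zero}  P? = z≤n
count≤n {suc n} P? with P? zero
... | yes _ = s≤s (count≤n (P? ∘ suc))
... | no  _ = ℕ.m≤n⇒m≤1+n (count≤n (P? ∘ suc))

count<n : ∀ {n} {P : Fin n → Set} (P? : Decidable₁ P) → ∀ x → ¬ P x → count P? < n
count<n P? x ¬p = ℕ.<-≤-trans (count-strict P? (λ _ → yes tt) _ x tt ¬p) (count≤n (λ _ → yes tt))

-- A missed value could be punched out, leaving an injection into a smaller set.
injective⇒surjective : ∀ {n} {f : Fin n → Fin n} → (∀ {x y} → f x ≡ f y → x ≡ y) → ∀ y → ∃ λ x → f x ≡ y
injective⇒surjective {suc n} {f} inj y with Fin.any? (λ x → f x Fin.≟ y)
... | yes hit = hit
... | no miss = contradiction (Fin.injective⇒≤ {f = λ x → Fin.punchOut (avoids x)} reduced-injective) ℕ.1+n≰n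
  where
  avoids : ∀ x → y ≢ f x
  avoids x e = miss (x , sym e)
  reduced-injective : ∀ {x z} → Fin.punchOut (avoids x) ≡ Fin.punchOut (avoids z) → x ≡ z
  reduced-injective {x} {z} e = inj (Fin.punchOut-injective (avoids x) (avoids z) e)

-- Pairs of words as values of a parameter word

one : ∀ {A : Set} → A → Fin 1 → A
one a _ = a

two : ∀ {A : Set} → A → A → Fin 2 → A
two a c zero    = a
two a c (suc _) = c

fill : ∀ {b} n → Fin b → PW b 0 n
fill zero    x = ε
fill (suc n) x = x ▹ fill n x

eval-fill : ∀ {A : Set} {b} n (x : Fin b) {σ : Fin b → A} {τ} → eval (fill n x) σ τ ≡ replicate n (σ x)
eval-fill zero    x = refl
eval-fill (suc n) x = cong (_ ∷_) (eval-fill n x)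

module _ {A : Set} where

  -- A pair of words is read column by column. With `σ` and `σ′` the identity, a seen column is one
  -- where the words agree; general `σ` and `σ′` are needed because the column of a parameter counts
  -- as seen after its first occurrence.
  Seen : ∀ {b} → (σ σ′ : Fin b → A) → A → A → Set
  Seen σ σ′ x x′ = ∃ λ y → x ≡ σ y × x′ ≡ σ′ y

  Realises : ∀ {b d n} → PW b d n → (σ σ′ : Fin b → A) → (τ τ′ : Fin d → A) → (v v′ : Fin n → A) → Set
  Realises q σ σ′ τ τ′ v v′ = eval q σ τ ≡ tabulate v × eval q σ′ τ′ ≡ tabulate v′

  Is : (a a′ x x′ : A) → Set
  Is a a′ x x′ = x ≡ a × x′ ≡ a′

  see : ∀ {b} {σ σ′ : Fin b → A} {a a′ x x′} → Seen σ σ′ x x′ ⊎ Is a a′ x x′ → Seen (a ◂ σ) (a′ ◂ σ′) x x′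
  see (inj₁ (y , e , e′)) = suc y , e , e′
  see (inj₂ (e , e′))     = zero , e , e′

  realise₀ : ∀ {b n} (σ σ′ : Fin b → A) {τ τ′} (v v′ : Fin n → A) → (∀ i → Seen σ σ′ (v i) (v′ i)) →
             Σ (PW b 0 n) λ q → Realises q σ σ′ τ τ′ v v′
  realise₀ {n = zero}  σ σ′ v v′ cols = ε , refl , refl
  realise₀ {n = suc n} σ σ′ v v′ cols with cols zero | realise₀ σ σ′ (v ∘ suc) (v′ ∘ suc) (cols ∘ suc)
  ... | y , e , e′ | q , f , f′ = y ▹ q , cong₂ _∷_ (sym e) f , cong₂ _∷_ (sym e′) f′

  realise₁ : ∀ {b n} (σ σ′ : Fin b → A) {a a′} (v v′ : Fin n → A) →
             (∀ i → Seen σ σ′ (v i) (v′ i) ⊎ Is a a′ (v i) (v′ i)) →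
             (∀ i → Seen σ σ′ (v i) (v′ i)) ⊎ Σ (PW b 1 n) λ q → Realises q σ σ′ (one a) (one a′) v v′
  realise₁ {n = zero}  σ σ′ v v′ cols = inj₁ λ ()
  realise₁ {n = suc n} σ σ′ {a} {a′} v v′ cols with cols zero
  ... | inj₂ (e , e′) with realise₀ (a ◂ σ) (a′ ◂ σ′) (v ∘ suc) (v′ ∘ suc) (see ∘ cols ∘ suc)
  ...   | q , f , f′ = inj₂ (✶ q , cong₂ _∷_ (sym e) f , cong₂ _∷_ (sym e′) f′)
  realise₁ {n = suc n} σ σ′ v v′ cols | inj₁ (y , e , e′) with realise₁ σ σ′ (v ∘ suc) (v′ ∘ suc) (cols ∘ suc)
  ... | inj₁ all         = inj₁ λ { zero → y , e , e′ ; (suc i) → all i }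
  ... | inj₂ (q , f , f′) = inj₂ (y ▹ q , cong₂ _∷_ (sym e) f , cong₂ _∷_ (sym e′) f′)

  realise₁-at : ∀ {b n} (σ σ′ : Fin b → A) {a a′} (v v′ : Fin n → A) x → Is a a′ (v x) (v′ x) →
                (∀ i → i ≢ x → Seen σ σ′ (v i) (v′ i)) →
                Σ (PW b 1 n) λ q → Realises q σ σ′ (one a) (one a′) v v′
  realise₁-at σ σ′ v v′ zero (e , e′) cols
    with realise₀ (_ ◂ σ) (_ ◂ σ′) (v ∘ suc) (v′ ∘ suc) (λ i → see (inj₁ (cols (suc i) λ ())))
  ... | q , f , f′ = ✶ q , cong₂ _∷_ (sym e) f , cong₂ _∷_ (sym e′) f′
  realise₁-at σ σ′ v v′ (suc x) at cols
    with cols zero (λ ()) | realise₁-at σ σ′ (v ∘ suc) (v′ ∘ suc) x at (λ i i≢x → cols (suc i) (i≢x ∘ Fin.suc-injective))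
  ... | y , e , e′ | q , f , f′ = y ▹ q , cong₂ _∷_ (sym e) f , cong₂ _∷_ (sym e′) f′

  -- The position `j` in the last case is what later shows that a coordinate before the decisive one
  -- is being lowered.
  Realisation₂ : ∀ {b n} (σ σ′ : Fin b → A) (a a′ c c′ : A) (v v′ : Fin n → A) → Fin n → Set
  Realisation₂ {b} {n} σ σ′ a a′ c c′ v v′ x =
    (Σ (PW b 1 n) λ q → Realises q σ σ′ (one a) (one a′) v v′) ⊎
    (Σ (PW b 2 n) λ q → Realises q σ σ′ (two a c) (two a′ c′) v v′) ⊎
    (Σ (PW b 2 n) λ q → Realises q σ σ′ (two c a) (two c′ a′) v v′ × ∃ λ j → j Fin.< x × Is c c′ (v j) (v′ j))

  realise₂ : ∀ {b n} (σ σ′ : Fin b → A) {a a′ c c′} (v v′ : Fin n → A) x → Is a a′ (v x) (v′ x) →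
             (∀ i → i ≢ x → Seen σ σ′ (v i) (v′ i) ⊎ Is c c′ (v i) (v′ i)) →
             Realisation₂ σ σ′ a a′ c c′ v v′ x
  realise₂ σ σ′ {a} {a′} {c} {c′} v v′ zero (e , e′) cols with realise₁ (a ◂ σ) (a′ ◂ σ′) (v ∘ suc) (v′ ∘ suc) cols′
    where
    cols′ : ∀ i → Seen (a ◂ σ) (a′ ◂ σ′) (v (suc i)) (v′ (suc i)) ⊎ Is c c′ (v (suc i)) (v′ (suc i))
    cols′ i with cols (suc i) (λ ())
    ... | inj₁ seen = inj₁ (see (inj₁ seen))
    ... | inj₂ new  = inj₂ new
  ... | inj₂ (q , f , f′) = inj₂ (inj₁ (✶ q , cong₂ _∷_ (sym e) f , cong₂ _∷_ (sym e′) f′))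
  ... | inj₁ all with realise₀ (a ◂ σ) (a′ ◂ σ′) (v ∘ suc) (v′ ∘ suc) all
  ...   | q , f , f′ = inj₁ (✶ q , cong₂ _∷_ (sym e) f , cong₂ _∷_ (sym e′) f′)
  realise₂ σ σ′ {a} {a′} {c} {c′} v v′ (suc x) at cols with cols zero (λ ())
  ... | inj₂ (e , e′)
    with realise₁-at (c ◂ σ) (c′ ◂ σ′) (v ∘ suc) (v′ ∘ suc) x at
           (λ i i≢x → see (cols (suc i) (i≢x ∘ Fin.suc-injective)))
  ...   | q , f , f′ = inj₂ (inj₂ (✶ q , (cong₂ _∷_ (sym e) f , cong₂ _∷_ (sym e′) f′) , zero , s≤s z≤n , e , e′))
  realise₂ σ σ′ {a} {a′} {c} {c′} v v′ (suc x) at cols | inj₁ (y , e , e′)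
    with realise₂ σ σ′ (v ∘ suc) (v′ ∘ suc) x at (λ i i≢x → cols (suc i) (i≢x ∘ Fin.suc-injective))
  ... | inj₁ (q , f , f′)        = inj₁ (y ▹ q , cong₂ _∷_ (sym e) f , cong₂ _∷_ (sym e′) f′)
  ... | inj₂ (inj₁ (q , f , f′)) = inj₂ (inj₁ (y ▹ q , cong₂ _∷_ (sym e) f , cong₂ _∷_ (sym e′) f′))
  ... | inj₂ (inj₂ (q , (f , f′) , j , j<x , h)) =
    inj₂ (inj₂ (y ▹ q , (cong₂ _∷_ (sym e) f , cong₂ _∷_ (sym e′) f′) , suc j , s≤s j<x , h))

-- For `b ≤ a`, the number `t` is clamped to the interval from `b` to `a`; for `a ≤ b` the value is
-- always `b`. So all coordinates that move when `t` changes by one make the same step.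
clamp : ∀ a b t → b ⊔ (a ⊓ suc t) ≡ b ⊔ (a ⊓ t) ⊎
                  (b ⊔ (a ⊓ suc t) ≡ suc t × b ⊔ (a ⊓ t) ≡ t × b ≤ t × t < a)
clamp a b t with a ≤? t
... | yes a≤t = inj₁ (cong (b ⊔_) (trans (ℕ.m≤n⇒m⊓n≡m (ℕ.m≤n⇒m≤1+n a≤t)) (sym (ℕ.m≤n⇒m⊓n≡m a≤t))))
... | no a≰t with b ≤? t
... | yes b≤t rewrite ℕ.m≥n⇒m⊓n≡n (ℕ.≰⇒> a≰t) | ℕ.m≥n⇒m⊓n≡n (ℕ.<⇒≤ (ℕ.≰⇒> a≰t)) =
  inj₂ (ℕ.m≤n⇒m⊔n≡n (ℕ.m≤n⇒m≤1+n b≤t) , ℕ.m≤n⇒m⊔n≡n b≤t , b≤t , ℕ.≰⇒> a≰t)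
... | no b≰t rewrite ℕ.m≥n⇒m⊓n≡n (ℕ.≰⇒> a≰t) | ℕ.m≥n⇒m⊓n≡n (ℕ.<⇒≤ (ℕ.≰⇒> a≰t)) =
  inj₁ (trans (ℕ.m≥n⇒m⊔n≡m (ℕ.≰⇒> b≰t)) (sym (ℕ.m≥n⇒m⊔n≡m (ℕ.<⇒≤ (ℕ.≰⇒> b≰t)))))

-- The order of the letters and the preorder on steps

module HomogeneousOrder (k′ D′ : ℕ) (_≺_ : Rel (Word (suc k′) (3 + D′)) 0ℓ) (sto : IsStrictTotalOrder _≡_ _≺_)
                        (hom₁ : Homogeneous 1 _≺_) (hom₂ : Homogeneous 2 _≺_) where

  k = suc k′
  D = 3 + D′

  open IsStrictTotalOrder sto using (compare; irrefl; asym) renaming (trans to ≺-trans; _<?_ to _≺?_)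

  infix 4 _⋖_ _≼_
  _⋖_ : Rel (Fin k) 0ℓ
  a ⋖ b = replicate D a ≺ replicate D b

  _≼_ : Rel (Word k D) 0ℓ
  w ≼ w′ = w ≡ w′ ⊎ w ≺ w′

  ≼-≺-trans : ∀ {u v w} → u ≼ v → v ≺ w → u ≺ w
  ≼-≺-trans (inj₁ refl) h = h
  ≼-≺-trans (inj₂ g)    h = ≺-trans g h

  ≺-≼-trans : ∀ {u v w} → u ≺ v → v ≼ w → u ≺ w
  ≺-≼-trans h (inj₁ refl) = h
  ≺-≼-trans h (inj₂ g)    = ≺-trans h g

  ⋖-total : ∀ {a b} → a ≢ b → a ⋖ b ⊎ b ⋖ a
  ⋖-total {a} {b} a≢b with compare (replicate D a) (replicate D b)
  ... | tri< h _ _ = inj₁ h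
  ... | tri> _ _ h = inj₂ h
  ... | tri≈ _ e _ = contradiction (cong Vec.head e) a≢b

  -- Constant words are the values of the word with one parameter in all positions, and homogeneity
  -- carries their comparison over to `q`.
  raise : ∀ {a a′} → a ⋖ a′ → (q : PW k 1 D) → q ⟨ one a ⟩ ≺ q ⟨ one a′ ⟩
  raise {a} {a′} a⋖a′ q = hom₁ (✶ fill (2 + D′) zero) q (one a) (one a′)
    (≡.subst₂ _≺_ (sym (constant a)) (sym (constant a′)) a⋖a′)
    where
    constant : ∀ x → (✶ fill (2 + D′) zero) ⟨ one x ⟩ ≡ replicate D x
    constant x = cong (x ∷_) (eval-fill (2 + D′) zero)

  rank< : (b : Fin k) → count (λ c → replicate D c ≺? replicate D b) < k
  rank< b = count<n (λ c → replicate D c ≺? replicate D b) b (irrefl refl)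

  abstract
    pos : Fin k → Fin k
    pos b = fromℕ< (rank< b)

    pos-mono : ∀ {a b} → a ⋖ b → pos a Fin.< pos b
    pos-mono {a} {b} a⋖b = ≡.subst₂ _<_ (sym (Fin.toℕ-fromℕ< (rank< a))) (sym (Fin.toℕ-fromℕ< (rank< b)))
      (count-strict (λ c → replicate D c ≺? replicate D a) (λ c → replicate D c ≺? replicate D b)
        (λ c c⋖a → ≺-trans c⋖a a⋖b) a a⋖b (irrefl refl))

  pos-injective : ∀ {a b} → pos a ≡ pos b → a ≡ b
  pos-injective {a} {b} e with a Fin.≟ b
  ... | yes a≡b = a≡b
  ... | no a≢b with ⋖-total a≢b
  ... | inj₁ a⋖b = contradiction (cong toℕ e) (ℕ.<⇒≢ (pos-mono a⋖b))
  ... | inj₂ b⋖a = contradiction (cong toℕ (sym e)) (ℕ.<⇒≢ (pos-mono b⋖a))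

  pos-reflects : ∀ {a b} → pos a Fin.< pos b → a ⋖ b
  pos-reflects {a} {b} lt with a Fin.≟ b
  ... | yes refl = contradiction lt (ℕ.<-irrefl refl)
  ... | no a≢b with ⋖-total a≢b
  ... | inj₁ a⋖b = a⋖b
  ... | inj₂ b⋖a = contradiction (pos-mono b⋖a) (ℕ.<-asym lt)

  pos-surjective : ∀ y → ∃ λ x → pos x ≡ y
  pos-surjective = injective⇒surjective pos-injective

  pos≤k′ : ∀ a → toℕ (pos a) ≤ k′
  pos≤k′ a = ℕ.≤-pred (Fin.toℕ<n (pos a))

  abstract
    -- Positions beyond the last letter are truncated to k′.
    letter : ℕ → Fin k
    letter n = proj₁ (pos-surjective (fromℕ< (s≤s (ℕ.m⊓n≤n n k′))))

    pos-letter : ∀ {n} → n ≤ k′ → toℕ (pos (letter n)) ≡ n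
    pos-letter {n} n≤k′ = trans (cong toℕ (proj₂ (pos-surjective (fromℕ< (s≤s (ℕ.m⊓n≤n n k′))))))
      (trans (Fin.toℕ-fromℕ< (s≤s (ℕ.m⊓n≤n n k′))) (ℕ.m≤n⇒m⊓n≡m n≤k′))

  letter-pos : ∀ a → letter (toℕ (pos a)) ≡ a
  letter-pos a = pos-injective (Fin.toℕ-injective (pos-letter (pos≤k′ a)))

  letter-suc : ∀ {s} → s < k′ → letter s ⋖ letter (suc s)
  letter-suc s<k′ = pos-reflects (≡.subst₂ _<_ (sym (pos-letter (ℕ.<⇒≤ s<k′))) (sym (pos-letter s<k′)) (ℕ.n<1+n _))

  letter-suc-≢ : ∀ {s} → s < k′ → letter s ≢ letter (suc s)
  letter-suc-≢ s<k′ e = irrefl (cong (replicate D) e) (letter-suc s<k′)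

  -- Raising letter s to letter (1 + s) at the parameter that occurs first outweighs lowering letter (1 + t) to
  -- letter t at the other one.
  First : ℕ → ℕ → Set
  First s t = ∀ (q : PW k 2 D) →
    q ⟨ two (letter s) (letter (suc t)) ⟩ ≺ q ⟨ two (letter (suc s)) (letter t) ⟩

  Second : ℕ → ℕ → Set
  Second s t = ∀ (q : PW k 2 D) →
    q ⟨ two (letter (suc t)) (letter s) ⟩ ≺ q ⟨ two (letter t) (letter (suc s)) ⟩

  initial : PW k 2 D
  initial = ✶ ✶ fill (suc D′) (suc (suc zero))

  First? : Decidable First
  First? s t with initial ⟨ two (letter s) (letter (suc t)) ⟩ ≺? initial ⟨ two (letter (suc s)) (letter t) ⟩
  ... | yes h = yes λ q → hom₂ initial q (two (letter s) (letter (suc t))) (two (letter (suc s)) (letter t)) h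
  ... | no ¬h = no λ f → ¬h (f initial)

  -- `First t s` and `Second s t` compare the same two words in opposite directions.
  ¬First⇒Second : ∀ {s t} → t < k′ → ¬ First t s → Second s t
  ¬First⇒Second {s} {t} t<k′ ¬f
    with compare (initial ⟨ two (letter (suc t)) (letter s) ⟩) (initial ⟨ two (letter t) (letter (suc s)) ⟩)
  ... | tri< h _ _ = λ q → hom₂ initial q (two (letter (suc t)) (letter s)) (two (letter t) (letter (suc s))) h
  ... | tri≈ _ e _ = contradiction (sym (cong Vec.head e)) (letter-suc-≢ t<k′)
  ... | tri> _ _ h =
    contradiction (λ q → hom₂ initial q (two (letter t) (letter (suc s))) (two (letter (suc t)) (letter s)) h) ¬f

  triple : Fin k → Fin k → Fin k → Word k D
  triple x y z = x ∷ y ∷ z ∷ replicate D′ zero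

  first-second : ∀ z x y → (✶ ✶ suc (suc z) ▹ fill D′ (suc (suc zero))) ⟨ two x y ⟩ ≡ triple x y z
  first-second z x y = cong (λ v → x ∷ y ∷ z ∷ v) (eval-fill D′ (suc (suc zero)))

  second-third : ∀ z x y → (z ▹ ✶ ✶ fill D′ (suc (suc zero))) ⟨ two x y ⟩ ≡ triple z x y
  second-third z x y = cong (λ v → z ∷ x ∷ y ∷ v) (eval-fill D′ (suc (suc zero)))

  first-third : ∀ z x y → (✶ suc z ▹ ✶ fill D′ (suc (suc zero))) ⟨ two x y ⟩ ≡ triple x z y
  first-third z x y = cong (λ v → x ∷ z ∷ y ∷ v) (eval-fill D′ (suc (suc zero)))

  first=third : ∀ x y → (✶ ✶ suc zero ▹ fill D′ (suc (suc zero))) ⟨ two x y ⟩ ≡ triple x y x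
  first=third x y = cong (λ v → x ∷ y ∷ x ∷ v) (eval-fill D′ (suc (suc zero)))

  only-first : ∀ y z x → (✶ suc y ▹ suc z ▹ fill D′ (suc zero)) ⟨ one x ⟩ ≡ triple x y z
  only-first y z x = cong (λ v → x ∷ y ∷ z ∷ v) (eval-fill D′ (suc zero))

  -- On three positions, `s` rises while `t` falls in the middle; then `t` rises again while `u`
  -- falls on the right. The middle letter is restored, leaving a 2-parameter comparison of `s` with
  -- `u`.
  First-trans : ∀ {s t u} → First s t → First t u → First s u
  First-trans {s} {t} {u} f g q = hom₂ (✶ suc (letter (suc t)) ▹ ✶ fill D′ (suc (suc zero))) q _ _
    (≡.subst₂ _≺_ (sym (first-third _ _ _)) (sym (first-third _ _ _))
      (≺-trans (≡.subst₂ _≺_ (first-second _ _ _) (first-second _ _ _) (f (✶ ✶ suc (suc (letter (suc u))) ▹ fill D′ _)))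
               (≡.subst₂ _≺_ (second-third _ _ _) (second-third _ _ _) (g (letter (suc s) ▹ ✶ ✶ fill D′ _)))))

  -- If the later change always won, then raising s at position 2 would outweigh lowering t at positions 1 and 3,
  -- while raising t back at position 3 would outweigh lowering s back at position 2.
  First-total : ∀ {s t} → s < k′ → t < k′ → First s t ⊎ First t s
  First-total {s} {t} s<k′ t<k′ with First? s t | First? t s
  ... | yes f | _     = inj₁ f
  ... | no _  | yes f = inj₂ f
  -- Both moves together only lower position 1 by the step `t`, which `raise` forbids.
  ... | no ¬f | no ¬g = contradiction
      (≺-trans
        (≡.subst₂ _≺_ (first=third _ _) (first=third _ _)
          (¬First⇒Second t<k′ ¬g (✶ ✶ suc zero ▹ fill D′ _)))
        (≡.subst₂ _≺_ (second-third _ _ _) (second-third _ _ _)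
          (¬First⇒Second s<k′ ¬f (letter t ▹ ✶ ✶ fill D′ _))))
      (asym (≡.subst₂ _≺_ (only-first _ _ _) (only-first _ _ _)
        (raise (letter-suc t<k′) (✶ suc (letter s) ▹ suc (letter (suc t)) ▹ fill D′ _))))

  rank : ℕ → ℕ
  rank s = count {k′} (λ c → First? s (toℕ c))

  First⇒rank≤ : ∀ {s t} → First s t → rank t ≤ rank s
  First⇒rank≤ {s} {t} f = count-mono {k′} (λ c → First? t (toℕ c)) (λ c → First? s (toℕ c)) λ c g → First-trans f g

  rank≤⇒First : ∀ {s t} → s < k′ → t < k′ → rank t ≤ rank s → First s t
  rank≤⇒First {s} {t} s<k′ t<k′ le with First? s t
  ... | yes f = f
  -- By totality `First t s` holds, so what is counted for `s` is also counted for `t`, and `t`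
  -- moreover counts itself.
  ... | no ¬f = contradiction le (ℕ.<⇒≱ (count-strict (λ c → First? s (toℕ c)) (λ c → First? t (toℕ c))
        (λ c g → First-trans t⊵s g) (fromℕ< t<k′) (at t<k′ t⊵t) λ f → ¬f (≡.subst (First s) (Fin.toℕ-fromℕ< t<k′) f)))
    where
    t⊵s : First t s
    t⊵s with First-total s<k′ t<k′
    ... | inj₁ f = contradiction f ¬f
    ... | inj₂ g = g
    t⊵t : First t t
    t⊵t with First-total t<k′ t<k′
    ... | inj₁ f = f
    ... | inj₂ f = f
    at : ∀ {t u} (u<k′ : u < k′) → First t u → First t (toℕ (fromℕ< u<k′))
    at {t} u<k′ = ≡.subst (First t) (sym (Fin.toℕ-fromℕ< u<k′))

  rank<⇒Second : ∀ {s t} → t < k′ → rank t < rank s → Second s t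
  rank<⇒Second t<k′ lt = ¬First⇒Second t<k′ λ f → ℕ.<⇒≱ lt (First⇒rank≤ f)

  unchanged : {x x′ : Fin k} → x ≡ x′ → Seen id id x x′
  unchanged e = _ , refl , sym e

  -- All positions that go from letter `t` to the next do so together, as occurrences of one
  -- parameter. Where no position moves the word stays the same, hence `≼`.
  raise-all : ∀ (f g : Fin D → ℕ) → (∀ z → f z ≤ g z) → (∀ z → g z ≤ k′) →
              tabulate (letter ∘ f) ≼ tabulate (letter ∘ g)
  raise-all f g f≤g g≤k′ = ≡.subst (tabulate (letter ∘ f) ≼_)
    (Vec.tabulate-cong λ z → cong letter (trans (cong (f z ⊔_) (ℕ.m≤n⇒m⊓n≡m (g≤k′ z))) (ℕ.m≤n⇒m⊔n≡n (f≤g z))))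
    (climb k′ ℕ.≤-refl)
    where
    level : ℕ → Fin D → ℕ
    level t z = f z ⊔ (g z ⊓ t)
    step-up : ∀ t → t < k′ → tabulate (letter ∘ level t) ≼ tabulate (letter ∘ level (suc t))
    step-up t t<k′ with realise₁ id id {letter t} {letter (suc t)} (letter ∘ level t) (letter ∘ level (suc t)) cols
      where
      cols : ∀ z → Seen id id (letter (level t z)) (letter (level (suc t) z)) ⊎
                   Is (letter t) (letter (suc t)) (letter (level t z)) (letter (level (suc t) z))
      cols z with clamp (g z) (f z) t
      ... | inj₁ e            = inj₁ (unchanged (cong letter (sym e)))
      ... | inj₂ (e , e′ , _) = inj₂ (cong letter e′ , cong letter e)
    ... | inj₁ all          = inj₁ (Vec.tabulate-cong λ z → trans (proj₁ (proj₂ (all z))) (sym (proj₂ (proj₂ (all z)))))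
    ... | inj₂ (q , e , e′) = inj₂ (≡.subst₂ _≺_ e e′ (raise (letter-suc t<k′) q))
    climb : ∀ t → t ≤ k′ → tabulate (letter ∘ f) ≼ tabulate (letter ∘ level t)
    climb zero    _    = inj₁ (Vec.tabulate-cong λ z →
      cong letter (sym (trans (cong (f z ⊔_) (ℕ.⊓-zeroʳ (g z))) (ℕ.⊔-identityʳ (f z)))))
    climb (suc t) t<k′ with climb t (ℕ.<⇒≤ t<k′) | step-up t t<k′
    ... | inj₁ e | h      = ≡.subst (_≼ tabulate (letter ∘ level (suc t))) (sym e) h
    ... | inj₂ g | h      = inj₂ (≺-≼-trans g h)

-- Cartesian trees

mutual
  lcaRank-sym : ∀ {m} (T : STree m) p q → lcaRank T p q ≡ lcaRank T q p
  lcaRank-sym leaf       p q = refl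
  lcaRank-sym (node r f) p q = lcaRankF-sym r f p q

  lcaRankF-sym : ∀ {c m} r (f : Forest c m) p q → lcaRankF r f p q ≡ lcaRankF r f q p
  lcaRankF-sym r (_∷_ {a} t f) p q with splitAt a p | splitAt a q
  ... | inj₁ p′ | inj₁ q′ = lcaRank-sym t p′ q′
  ... | inj₁ _  | inj₂ _  = refl
  ... | inj₂ _  | inj₁ _  = refl
  ... | inj₂ p′ | inj₂ q′ = lcaRankF-sym r f p′ q′

mutual
  lcaRank-≤ : ∀ {m R} (T : STree m) → Below R T → WeaklyDecreasing T → ∀ p q → lcaRank T p q ≤ R
  lcaRank-≤ leaf       _    _  p q = z≤n
  lcaRank-≤ (node r f) r<R  wd p q = ℕ.≤-trans (lcaRankF-≤ f wd p q) (ℕ.<⇒≤ r<R)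

  lcaRankF-≤ : ∀ {c m R} (f : Forest c m) → WDF R f → ∀ p q → lcaRankF R f p q ≤ R
  lcaRankF-≤ (_∷_ {a} t f) (below , wd , wdf) p q with splitAt a p | splitAt a q
  ... | inj₁ p′ | inj₁ q′ = lcaRank-≤ t below wd p′ q′
  ... | inj₁ _  | inj₂ _  = ℕ.≤-refl
  ... | inj₂ _  | inj₁ _  = ℕ.≤-refl
  ... | inj₂ p′ | inj₂ q′ = lcaRankF-≤ f wdf p′ q′

singleton : ∀ {m} → STree m → Forest 1 m
singleton {m} T = ≡.subst (Forest 1) (ℕ.+-identityʳ m) (T ∷ [])

singleton-WDF : ∀ {m R} (T : STree m) → Below R T → WeaklyDecreasing T → WDF R (singleton T)
singleton-WDF {m} {R} T below wd = transport (ℕ.+-identityʳ m)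
  where
  transport : ∀ {m′} (e : m + 0 ≡ m′) → WDF R (≡.subst (Forest 1) e (T ∷ []))
  transport refl = below , wd , tt

singleton-lcaRankF : ∀ {m} R (T : STree m) p q → lcaRankF R (singleton T) p q ≡ lcaRank T p q
singleton-lcaRankF {m} R T p q = transport (ℕ.+-identityʳ m) p q refl refl
  where
  transport : ∀ {m′} (e : m + 0 ≡ m′) (p′ q′ : Fin m′) → toℕ p′ ≡ toℕ p → toℕ q′ ≡ toℕ q →
              lcaRankF R (≡.subst (Forest 1) e (T ∷ [])) p′ q′ ≡ lcaRank T p q
  transport refl p′ q′ ep eq
    rewrite Fin.toℕ-injective (trans ep (sym (Fin.toℕ-↑ˡ p 0))) | Fin.toℕ-injective (trans eq (sym (Fin.toℕ-↑ˡ q 0)))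
          | Fin.splitAt-↑ˡ m p 0 | Fin.splitAt-↑ˡ m q 0 = refl

-- A new leftmost leaf, whose lowest common ancestor with the previous leftmost leaf has rank s.
insert : ∀ {m} → ℕ → STree m → STree (suc m)
insert s leaf = node s (leaf ∷ (leaf ∷ []))
insert s (node r (t ∷ f)) with ℕ.<-cmp s r
... | tri< _ _ _ = node r (insert s t ∷ f)
-- Ranks must strictly decrease along paths, so a tie adds a child to the existing node; this is how
-- nodes with more than two children arise.
... | tri≈ _ _ _ = node r (leaf ∷ (t ∷ f))
... | tri> _ _ _ = node s (leaf ∷ singleton (node r (t ∷ f)))

insert-Below : ∀ {m R s} (T : STree m) → s < R → Below R T → Below R (insert s T)
insert-Below leaf s<R _ = s<R
insert-Below {s = s} (node r (t ∷ f)) s<R r<R with ℕ.<-cmp s r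
... | tri< _ _ _ = r<R
... | tri≈ _ _ _ = r<R
... | tri> _ _ _ = s<R

insert-WeaklyDecreasing : ∀ {m} s (T : STree m) → WeaklyDecreasing T → WeaklyDecreasing (insert s T)
insert-WeaklyDecreasing s leaf _ = tt , tt , tt , tt , tt
insert-WeaklyDecreasing s (node r (t ∷ f)) (below , wd , wdf) with ℕ.<-cmp s r
... | tri< s<r _ _ = insert-Below t s<r below , insert-WeaklyDecreasing s t wd , wdf
... | tri≈ _ _ _   = tt , tt , below , wd , wdf
... | tri> _ _ r<s = tt , tt , singleton-WDF (node r (t ∷ f)) r<s (below , wd , wdf)

insert-lcaRank-suc : ∀ {m} s (T : STree m) p q → lcaRank (insert s T) (suc p) (suc q) ≡ lcaRank T p q
insert-lcaRank-suc s leaf zero zero = refl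
insert-lcaRank-suc s (node r (_∷_ {a} t f)) p q with ℕ.<-cmp s r
... | tri≈ _ _ _ = refl
... | tri> _ _ _ = singleton-lcaRankF s (node r (t ∷ f)) p q
... | tri< _ _ _ with splitAt a p | splitAt a q
... | inj₁ p′ | inj₁ q′ = insert-lcaRank-suc s t p′ q′
... | inj₁ _  | inj₂ _  = refl
... | inj₂ _  | inj₁ _  = refl
... | inj₂ p′ | inj₂ q′ = refl

nonempty : ∀ {m} → STree m → m ≢ 0
nonempty leaf                   ()
nonempty (node r (_∷_ {a} t f)) e = nonempty t (ℕ.m+n≡0⇒m≡0 a e)

splitAt-zero : ∀ a {b} → a ≢ 0 → (z : Fin (a + b)) → toℕ z ≡ 0 → ∃ λ z′ → toℕ z′ ≡ 0 × splitAt a z ≡ inj₁ z′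
splitAt-zero zero    a≢0 z e = contradiction refl a≢0
splitAt-zero (suc a) a≢0 zero e = zero , refl , refl

splitAt-positive : ∀ a {b} (q : Fin (a + b)) {q′} → toℕ q ≢ 0 → splitAt a q ≡ inj₁ q′ → toℕ q′ ≢ 0
splitAt-positive (suc a) zero    q≢0 e    = contradiction refl q≢0
splitAt-positive (suc a) (suc q) q≢0 e e′ with splitAt a q
splitAt-positive (suc a) (suc q) q≢0 refl () | inj₁ _

insert-lcaRank-01 : ∀ {m} s (T : STree m) (z : Fin m) → toℕ z ≡ 0 → lcaRank (insert s T) zero (suc z) ≡ s
insert-lcaRank-01 s leaf zero _ = refl
insert-lcaRank-01 s (node r (_∷_ {a} t f)) z e with ℕ.<-cmp s r
... | tri≈ _ s≡r _ = sym s≡r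
... | tri> _ _ _   = refl
... | tri< _ _ _ with splitAt-zero a (nonempty t) z e
... | z′ , e′ , eq rewrite eq = insert-lcaRank-01 s t z′ e′

-- The new leaf is attached on the leftmost path at height `s`: nodes of larger rank there keep both
-- leaves below them, while subtrees of smaller rank are separated from the new leaf at rank `s`.
insert-lcaRank-0 : ∀ {m} s (T : STree m) → WeaklyDecreasing T → (z q : Fin m) → toℕ z ≡ 0 → toℕ q ≢ 0 →
                   lcaRank (insert s T) zero (suc q) ≡ s ⊔ lcaRank T z q
insert-lcaRank-0 s leaf _ z zero _ q≢0 = contradiction refl q≢0
insert-lcaRank-0 s (node r (_∷_ {a} t f)) (below , wd , wdf) z q z≡0 q≢0 with ℕ.<-cmp s r
... | tri≈ _ refl _ = sym (ℕ.m≥n⇒m⊔n≡m (lcaRankF-≤ (t ∷ f) (below , wd , wdf) z q))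
... | tri> _ _ r<s  = sym (ℕ.m≥n⇒m⊔n≡m (ℕ.≤-trans (lcaRankF-≤ (t ∷ f) (below , wd , wdf) z q) (ℕ.<⇒≤ r<s)))
... | tri< s<r _ _ with splitAt-zero a (nonempty t) z z≡0 | splitAt a q in eq
... | z′ , z′≡0 , eq′ | inj₁ q′ rewrite eq′ = insert-lcaRank-0 s t wd z′ q′ z′≡0 (splitAt-positive a q q≢0 eq)
... | z′ , z′≡0 , eq′ | inj₂ q′ rewrite eq′ = sym (ℕ.m≤n⇒m⊔n≡n (ℕ.<⇒≤ s<r))

cartesian : ∀ m → (ℕ → ℕ) → STree (suc m)
cartesian zero    r = leaf
cartesian (suc m) r = insert (r 0) (cartesian m (r ∘ suc))

cartesian-WeaklyDecreasing : ∀ m r → WeaklyDecreasing (cartesian m r)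
cartesian-WeaklyDecreasing zero    r = tt
cartesian-WeaklyDecreasing (suc m) r = insert-WeaklyDecreasing (r 0) (cartesian m (r ∘ suc)) (cartesian-WeaklyDecreasing m (r ∘ suc))

IsMaxOn : (ℕ → ℕ) → ℕ → ℕ → ℕ → Set
IsMaxOn r p q M = (∀ u → p ≤ u → u < q → r u ≤ M) × ∃ λ u → p ≤ u × u < q × r u ≡ M

-- Each insertion of a leftmost leaf extends the interval by one step on the left and, by
-- `insert-lcaRank-0`, the maximum by the rank of that step.
cartesian-lcaRank : ∀ m r (p q : Fin (suc m)) → toℕ p < toℕ q →
                    IsMaxOn r (toℕ p) (toℕ q) (lcaRank (cartesian m r) p q)
cartesian-lcaRank (suc m) r (suc p) (suc q) (s≤s p<q)
  rewrite insert-lcaRank-suc (r 0) (cartesian m (r ∘ suc)) p q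
  with cartesian-lcaRank m (r ∘ suc) p q p<q
... | bound , u , p≤u , u<q , e = bound′ , suc u , s≤s p≤u , s≤s u<q , e
  where
  bound′ : ∀ u → suc (toℕ p) ≤ u → u < suc (toℕ q) → r u ≤ _
  bound′ (suc u) (s≤s p≤u) (s≤s u<q) = bound u p≤u u<q
cartesian-lcaRank (suc m) r zero (suc zero) _
  rewrite insert-lcaRank-01 (r 0) (cartesian m (r ∘ suc)) zero refl = bound , 0 , z≤n , s≤s z≤n , refl
  where
  bound : ∀ u → 0 ≤ u → u < 1 → r u ≤ r 0
  bound zero _ _ = ℕ.≤-refl
  bound (suc u) _ (s≤s ())
cartesian-lcaRank (suc m) r zero (suc (suc q)) _
  rewrite insert-lcaRank-0 (r 0) (cartesian m (r ∘ suc)) (cartesian-WeaklyDecreasing m (r ∘ suc))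
            zero (suc q) refl (λ ())
  with cartesian-lcaRank m (r ∘ suc) zero (suc q) (s≤s z≤n)
... | bound , u , _ , u<q , e = bound′ , attained
  where
  M = lcaRank (cartesian m (r ∘ suc)) zero (suc q)
  bound′ : ∀ u → 0 ≤ u → u < suc (suc (toℕ q)) → r u ≤ r 0 ⊔ M
  bound′ zero    _ _         = ℕ.m≤m⊔n (r 0) M
  bound′ (suc u) _ (s≤s u<q) = ℕ.≤-trans (bound u z≤n u<q) (ℕ.m≤n⊔m (r 0) M)
  attained : ∃ λ u → 0 ≤ u × u < suc (suc (toℕ q)) × r u ≡ r 0 ⊔ M
  attained with ℕ.⊔-sel (r 0) M
  ... | inj₁ left  = 0 , z≤n , s≤s z≤n , sym left
  ... | inj₂ right = suc u , z≤n , s≤s u<q , trans e (sym right)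

-- The final cube

blocks : ∀ {b} d K → PW b d (d * suc K)
blocks zero    K = ε
blocks (suc d) K = ✶ append (fill K zero) id (blocks d K)

lookup-blocks : ∀ {A : Set} {b} d K {σ : Fin b → A} {τ : Fin d → A} i (u : Fin (suc K)) →
                lookup (eval (blocks d K) σ τ) (combine i u) ≡ τ i
lookup-blocks (suc d) K {σ} {τ} i u
  rewrite eval-append (fill K zero) id (blocks {suc _} d K) {τ zero ◂ σ} {τ ∘ suc}
        | eval-fill K zero {τ zero ◂ σ} {λ i → τ (suc (i Fin.↑ˡ d))} = at i
  where
  rest : Vec _ (d * suc K)
  rest = eval (blocks d K) (τ zero ◂ σ) (τ ∘ suc)
  at : ∀ i → lookup (replicate (suc K) (τ zero) Vec.++ rest) (combine i u) ≡ τ i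
  at zero    = trans (Vec.lookup-++ˡ (replicate (suc K) (τ zero)) rest u) (Vec.lookup-replicate u (τ zero))
  at (suc i) = trans (Vec.lookup-++ʳ (replicate (suc K) (τ zero)) rest (combine i u)) (lookup-blocks d K i u)

IsFirstMaximum : ∀ {d} → (Fin d → Set) → (Fin d → ℕ) → Fin d → Set
IsFirstMaximum {d} D r i = Maximum i × (∀ j → j Fin.< i → ¬ Maximum j)
  where
  Maximum : Fin d → Set
  Maximum i = D i × (∀ j → D j → r j ≤ r i)

first-maximum : ∀ {d} {D : Fin d → Set} → Decidable₁ D → (r : Fin d → ℕ) →
                (∀ j → ¬ D j) ⊎ ∃ (IsFirstMaximum D r)
first-maximum {zero}  D? r = inj₁ λ ()
first-maximum {suc d} {D} D? r with D? zero | first-maximum (D? ∘ suc) (r ∘ suc)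
... | no ¬D₀ | inj₁ none = inj₁ λ { zero → ¬D₀ ; (suc j) → none j }
... | yes D₀ | inj₁ none =
  inj₂ (zero , (D₀ , λ { zero _ → ℕ.≤-refl ; (suc j) Dⱼ → contradiction Dⱼ (none j) }) , λ _ ())
... | no ¬D₀ | inj₂ (i , (Dᵢ , max) , first) =
  inj₂ (suc i , (Dᵢ , λ { zero D₀ → contradiction D₀ ¬D₀ ; (suc j) → max j }) ,
        λ { zero _ (D₀ , _) → ¬D₀ D₀ ; (suc j) (s≤s j<i) (Dⱼ , maxⱼ) → first j j<i (Dⱼ , maxⱼ ∘ suc) })
... | yes D₀ | inj₂ (i , (Dᵢ , max) , first) with r (suc i) ≤? r zero
... | yes rᵢ≤r₀ =
  inj₂ (zero , (D₀ , λ { zero _ → ℕ.≤-refl ; (suc j) Dⱼ → ℕ.≤-trans (max j Dⱼ) rᵢ≤r₀ }) , λ _ ())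
... | no rᵢ≰r₀ =
  inj₂ (suc i , (Dᵢ , λ { zero _ → ℕ.<⇒≤ (ℕ.≰⇒> rᵢ≰r₀) ; (suc j) → max j }) ,
        λ { zero _ (_ , max₀) → rᵢ≰r₀ (max₀ (suc i) Dᵢ)
          ; (suc j) (s≤s j<i) (Dⱼ , maxⱼ) → first j j<i (Dⱼ , maxⱼ ∘ suc) })

-- Used to exchange the two words, which reverses the inequations and the arguments of `lcaRank`.
first-maximum-cong : ∀ {d} {D D′ : Fin d → Set} {r r′ : Fin d → ℕ} → (∀ j → D j → D′ j) → (∀ j → D′ j → D j) → r ≗ r′ →
                     ∀ i → IsFirstMaximum D r i → IsFirstMaximum D′ r′ i
first-maximum-cong to from r≗r′ i ((Dᵢ , max) , first) =
  (to i Dᵢ , λ j D′ⱼ → ≡.subst₂ _≤_ (r≗r′ j) (r≗r′ i) (max j (from j D′ⱼ))) ,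
  λ j j<i (D′ⱼ , maxⱼ) → first j j<i
    (from j D′ⱼ , λ l Dₗ → ≡.subst₂ _≤_ (sym (r≗r′ l)) (sym (r≗r′ j)) (maxⱼ l (to l Dₗ)))

module Blocks (k′ d′ : ℕ) (_≺_ : Rel (Word (suc k′) (suc d′ * (3 + k′))) 0ℓ)
              (sto : IsStrictTotalOrder _≡_ _≺_) (hom₁ : Homogeneous 1 _≺_) (hom₂ : Homogeneous 2 _≺_) where

  open HomogeneousOrder k′ (k′ + d′ * (3 + k′)) _≺_ sto hom₁ hom₂ public
  open IsStrictTotalOrder sto using (irrefl; asym) renaming (trans to ≺-trans)

  d K : ℕ
  d = suc d′
  -- The descent spends one copy for each of the `k′` steps. The 3 provides, even for a single
  -- block, the three positions used in `First-trans` and `First-total`.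
  K = 3 + k′

  block : Fin D → Fin d
  block z = proj₁ (remQuot {d} K z)

  offset : Fin D → ℕ
  offset z = toℕ (proj₂ (remQuot {d} K z))

  toℕ-position : ∀ z → toℕ z ≡ K * toℕ (block z) + offset z
  toℕ-position z = trans (cong toℕ (sym (Fin.combine-remQuot {d} K z))) (Fin.toℕ-combine {d} {K} (block z) _)

  block-mono : ∀ {z y} → toℕ z < toℕ y → block z Fin.≤ block y
  block-mono {z} {y} z<y = ℕ.≮⇒≥ λ lt → ℕ.<-asym z<y
    (≡.subst₂ Fin._<_ (Fin.combine-remQuot {d} K y) (Fin.combine-remQuot {d} K z)
      (Fin.combine-monoˡ-< {d} {K} {block y} {block z} _ _ lt))

  -- `a` and `b` are the positions of the letters of the smaller and the larger word. Equal ranks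
  -- are harmless only from `i` on, since the earlier step wins a tie.
  module Descent (a b : Fin d → ℕ) (a≤k′ : ∀ j → a j ≤ k′) (b≤k′ : ∀ j → b j ≤ k′)
                 (i : Fin d) (s : ℕ) (aᵢ≤s : a i ≤ s) (s<bᵢ : s < b i)
                 (dominated : ∀ j t → b j ≤ t → t < a j → rank t ≤ rank s × (j Fin.< i → rank t < rank s)) where

    s<k′ : s < k′
    s<k′ = ℕ.<-≤-trans s<bᵢ (b≤k′ i)

    -- Copies with offset at least `t` have been raised, so going from `t + 1` down to `t` raises
    -- exactly the copy with offset `t`.
    raised : ℕ → ℕ → ℕ
    raised t u with t ≤? u
    ... | yes _ = suc s
    ... | no  _ = s

    raised-yes : ∀ {t u} → t ≤ u → raised t u ≡ suc s
    raised-yes {t} {u} t≤u with t ≤? u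
    ... | yes _  = refl
    ... | no t≰u = contradiction t≤u t≰u

    raised-no : ∀ {t u} → u < t → raised t u ≡ s
    raised-no {t} {u} u<t with t ≤? u
    ... | yes t≤u = contradiction t≤u (ℕ.<⇒≱ u<t)
    ... | no _    = refl

    raised-suc : ∀ {t u} → u ≢ t → raised (suc t) u ≡ raised t u
    raised-suc {t} {u} u≢t with t ≤? u
    ... | yes t≤u = raised-yes (ℕ.≤∧≢⇒< t≤u (u≢t ∘ sym))
    ... | no t≰u  = raised-no (ℕ.m≤n⇒m≤1+n (ℕ.≰⇒> t≰u))

    -- From level t + 1 to level t, one coordinate of block i goes up from s to s + 1, while in the other blocks
    -- all coordinates that still have to drop from t + 1 to t do so.
    level : ℕ → Fin D → ℕ
    level t z with block z Fin.≟ i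
    ... | yes _ = raised t (offset z)
    ... | no  _ = b (block z) ⊔ (a (block z) ⊓ t)

    stage : ℕ → Word k D
    stage t = tabulate (letter ∘ level t)

    Drops : ℕ → Fin D → Set
    Drops t z = level (suc t) z ≡ suc t × level t z ≡ t × block z ≢ i × b (block z) ≤ t × t < a (block z)

    module _ (t : ℕ) (t<k′ : t < k′) where

      t<K : t < K
      t<K = ℕ.m≤n⇒m≤o+n 3 t<k′

      x : Fin D
      x = combine {d} {K} i (fromℕ< t<K)

      block-x : block x ≡ i
      block-x = cong proj₁ (Fin.remQuot-combine {d} {K} i (fromℕ< t<K))

      offset-x : offset x ≡ t
      offset-x = trans (cong (toℕ ∘ proj₂) (Fin.remQuot-combine {d} {K} i (fromℕ< t<K))) (Fin.toℕ-fromℕ< t<K)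

      level-x : level (suc t) x ≡ s × level t x ≡ suc s
      level-x with block x Fin.≟ i
      ... | yes _ = raised-no (s≤s (ℕ.≤-reflexive offset-x)) , raised-yes (ℕ.≤-reflexive (sym offset-x))
      ... | no ≢i = contradiction block-x ≢i

      column : ∀ z → z ≢ x → level (suc t) z ≡ level t z ⊎ Drops t z
      column z z≢x with block z Fin.≟ i
      ... | yes e = inj₁ (raised-suc λ o → z≢x (Fin.toℕ-injective (trans (toℕ-position z)
                      (trans (cong₂ (λ j u → K * toℕ j + u) (trans e (sym block-x)) (trans o (sym offset-x)))
                             (sym (toℕ-position x))))))
      ... | no ≢i with clamp (a (block z)) (b (block z)) t
      ... | inj₁ e                  = inj₁ e
      ... | inj₂ (e , e′ , b≤ , <a) = inj₂ (e , e′ , ≢i , b≤ , <a)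

      raises-x : Is (letter s) (letter (suc s)) (letter (level (suc t) x)) (letter (level t x))
      raises-x = cong letter (proj₁ level-x) , cong letter (proj₂ level-x)

      columns : ∀ z → z ≢ x → Seen id id (letter (level (suc t) z)) (letter (level t z)) ⊎
                              Is (letter (suc t)) (letter t) (letter (level (suc t) z)) (letter (level t z))
      columns z z≢x with column z z≢x
      ... | inj₁ e            = inj₁ (unchanged (cong letter e))
      ... | inj₂ (e , e′ , _) = inj₂ (cong letter e , cong letter e′)

      -- Blocks are intervals, so a position before `x` and outside block `i` lies in an earlier
      -- block, where domination is strict.
      drop-before-x : ∀ z → z Fin.< x → Is (letter (suc t)) (letter t) (letter (level (suc t) z)) (letter (level t z)) →
                      rank t < rank s
      drop-before-x z z<x (e , e′) with column z (λ { refl → ℕ.<-irrefl refl z<x })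
      ... | inj₁ same = contradiction (trans (sym e′) (trans (cong letter (sym same)) e)) (letter-suc-≢ t<k′)
      ... | inj₂ (_ , _ , ≢i , b≤ , <a) = proj₂ (dominated (block z) t b≤ <a)
        (ℕ.≤∧≢⇒< (≡.subst (block z Fin.≤_) block-x (block-mono z<x)) (≢i ∘ Fin.toℕ-injective))

      stage-step : stage (suc t) ≺ stage t
      -- This is decided beforehand because the 2-parameter case of `realise₂` with `s` first names
      -- no dropping position from which domination could give `First s t`. If it fails, nothing
      -- drops at `t`.
      stage-step with First? s t
      ... | no ¬f with realise₁-at id id (letter ∘ level (suc t)) (letter ∘ level t) x raises-x no-drop
        where
        no-drop : ∀ z → z ≢ x → Seen id id (letter (level (suc t) z)) (letter (level t z))
        no-drop z z≢x with column z z≢x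
        ... | inj₁ e = unchanged (cong letter e)
        ... | inj₂ (_ , _ , _ , b≤ , <a) =
          contradiction (rank≤⇒First s<k′ t<k′ (proj₁ (dominated (block z) t b≤ <a))) ¬f
      ...   | q , e , e′ = ≡.subst₂ _≺_ e e′ (raise (letter-suc s<k′) q)
      stage-step | yes f with realise₂ id id (letter ∘ level (suc t)) (letter ∘ level t) x raises-x columns
      ... | inj₁ (q , e , e′)        = ≡.subst₂ _≺_ e e′ (raise (letter-suc s<k′) q)
      ... | inj₂ (inj₁ (q , e , e′)) = ≡.subst₂ _≺_ e e′ (f q)
      ... | inj₂ (inj₂ (q , (e , e′) , z , z<x , drop)) =
        ≡.subst₂ _≺_ e e′ (rank<⇒Second t<k′ (drop-before-x z z<x drop) q)

    descend : ∀ t → suc t ≤ k′ → stage (suc t) ≺ stage 0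
    descend zero    le = stage-step 0 le
    descend (suc t) le = ≺-trans (stage-step (suc t) le) (descend t (ℕ.<⇒≤ le))

    descend-from-top : stage k′ ≺ stage 0
    descend-from-top = ≡.subst (λ t → stage t ≺ stage 0) (ℕ.suc-pred k′ {{ℕ.>-nonZero (ℕ.≤-<-trans z≤n s<k′)}})
      (descend (ℕ.pred k′) (ℕ.≤-reflexive (ℕ.suc-pred k′ {{ℕ.>-nonZero (ℕ.≤-<-trans z≤n s<k′)}})))

    below-top : ∀ z → a (block z) ≤ level k′ z
    below-top z with block z Fin.≟ i
    ... | no _ = ℕ.≤-trans (ℕ.≤-reflexive (sym (ℕ.m≤n⇒m⊓n≡m (a≤k′ (block z))))) (ℕ.m≤n⊔m (b (block z)) _)
    ... | yes refl with k′ ≤? offset z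
    ... | yes _ = ℕ.m≤n⇒m≤1+n aᵢ≤s
    ... | no  _ = aᵢ≤s

    top-bounded : ∀ z → level k′ z ≤ k′
    top-bounded z with block z Fin.≟ i
    ... | no _ = ℕ.⊔-lub (b≤k′ (block z)) (ℕ.m⊓n≤n (a (block z)) k′)
    ... | yes _ with k′ ≤? offset z
    ... | yes _ = s<k′
    ... | no  _ = ℕ.<⇒≤ s<k′

    bottom-below : ∀ z → level 0 z ≤ b (block z)
    bottom-below z with block z Fin.≟ i
    ... | no _ = ℕ.⊔-lub ℕ.≤-refl (ℕ.≤-trans (ℕ.m⊓n≤n (a (block z)) 0) z≤n)
    ... | yes refl = ℕ.≤-trans (ℕ.≤-reflexive (raised-yes {0} {offset z} z≤n)) s<bᵢ

    -- Outside block `i`, the first raising reaches the larger of `a` and `b`, and the descent ends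
    -- at `b`; the last raising only has to lift block `i` from `s + 1` to its final letter.
    ascending : tabulate (letter ∘ a ∘ block) ≺ tabulate (letter ∘ b ∘ block)
    ascending = ≼-≺-trans (raise-all (a ∘ block) (level k′) below-top top-bounded)
      (≺-≼-trans descend-from-top (raise-all (level 0) (b ∘ block) bottom-below (b≤k′ ∘ block)))

  letter-word : ∀ (w : Word k d) → tabulate (letter ∘ toℕ ∘ pos ∘ lookup w ∘ block) ≡ blocks d (2 + k′) ⟨ lookup w ⟩
  letter-word w = trans (Vec.tabulate-cong λ z → trans (letter-pos (lookup w (block z))) (sym (at z)))
                        (Vec.tabulate∘lookup (blocks d (2 + k′) ⟨ lookup w ⟩))
    where
    at : ∀ z → lookup (blocks d (2 + k′) ⟨ lookup w ⟩) z ≡ lookup w (block z)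
    at z = trans (cong (lookup (blocks d (2 + k′) ⟨ lookup w ⟩)) (sym (Fin.combine-remQuot {d} K z)))
                 (lookup-blocks d (2 + k′) {id} {lookup w} (block z) (proj₂ (remQuot {d} K z)))

  _<ₖ_ : Rel (Fin k) 0ℓ
  a <ₖ b = pos a Fin.< pos b

  <ₖ-isStrictTotalOrder : IsStrictTotalOrder _≡_ _<ₖ_
  <ₖ-isStrictTotalOrder = record
    { isStrictPartialOrder = record
      { isEquivalence = isEquivalence
      ; irrefl = λ { refl → ℕ.<-irrefl refl }
      ; trans = ℕ.<-trans
      ; <-resp-≈ = (λ { refl h → h }) , λ { refl h → h } }
    ; compare = λ a b → cmp a b (Fin.<-cmp (pos a) (pos b)) }
    where
    cmp : ∀ a b → Tri (pos a Fin.< pos b) (pos a ≡ pos b) (pos b Fin.< pos a) → Tri (a <ₖ b) (a ≡ b) (b <ₖ a)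
    cmp a b (tri< h e g) = tri< h (e ∘ cong pos) g
    cmp a b (tri≈ h e g) = tri≈ h (pos-injective e) g
    cmp a b (tri> h e g) = tri> h (e ∘ cong pos) g

  T : STree k
  T = cartesian k′ rank

  PrecT⇒≺ : ∀ (w w′ : Word k d) → PrecT _<ₖ_ pos T w w′ → pull (blocks d (2 + k′)) _≺_ w w′
  PrecT⇒≺ w w′ (i , (wᵢ≢w′ᵢ , maximal) , first , wᵢ<w′ᵢ) with cartesian-lcaRank k′ rank _ _ wᵢ<w′ᵢ
  ... | _ , s , a≤s , s<b , rank-s =
    ≡.subst₂ _≺_ (letter-word w) (letter-word w′)
      (Descent.ascending (toℕ ∘ pos ∘ lookup w) (toℕ ∘ pos ∘ lookup w′) (pos≤k′ ∘ lookup w) (pos≤k′ ∘ lookup w′)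
        i s a≤s s<b dominated)
    where
    lca : Fin d → ℕ
    lca j = lcaRank T (pos (lookup w j)) (pos (lookup w′ j))
    dominated : ∀ j t → toℕ (pos (lookup w′ j)) ≤ t → t < toℕ (pos (lookup w j)) →
                rank t ≤ rank s × (j Fin.< i → rank t < rank s)
    dominated j t b≤t t<a = ≡.subst (rank t ≤_) (sym rank-s) (ℕ.≤-trans bound (maximal j differ)) ,
      -- Otherwise `j` would be a maximum before `i`.
      λ j<i → ≡.subst (rank t <_) (sym rank-s) (ℕ.≤-<-trans bound
        (ℕ.≰⇒> λ i≤j → first j j<i (differ , λ l l-differ → ℕ.≤-trans (maximal l l-differ) i≤j)))
      where
      differ : lookup w j ≢ lookup w′ j
      differ e = ℕ.<⇒≢ (ℕ.≤-<-trans b≤t t<a) (cong (toℕ ∘ pos) (sym e))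
      bound : rank t ≤ lca j
      bound = ≡.subst (rank t ≤_) (lcaRank-sym T (pos (lookup w′ j)) (pos (lookup w j)))
        (proj₁ (cartesian-lcaRank k′ rank (pos (lookup w′ j)) (pos (lookup w j)) (ℕ.≤-<-trans b≤t t<a)) t b≤t t<a)

  -- The words differ, so a decisive coordinate exists; if it pointed the other way, `PrecT⇒≺` would
  -- reverse the comparison.
  ≺⇒PrecT : ∀ (w w′ : Word k d) → pull (blocks d (2 + k′)) _≺_ w w′ → PrecT _<ₖ_ pos T w w′
  ≺⇒PrecT w w′ w≺w′ with first-maximum (λ j → ¬? (lookup w j Fin.≟ lookup w′ j))
                           (λ j → lcaRank T (pos (lookup w j)) (pos (lookup w′ j)))
  ... | inj₁ none = contradiction w≺w′ (irrefl (cong (λ v → blocks d (2 + k′) ⟨ lookup v ⟩)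
        (trans (sym (Vec.tabulate∘lookup w)) (trans
          (Vec.tabulate-cong λ j → decidable-stable (lookup w j Fin.≟ lookup w′ j) (none j))
          (Vec.tabulate∘lookup w′)))))
  ... | inj₂ (i , (differ , maximal) , first) with Fin.<-cmp (pos (lookup w i)) (pos (lookup w′ i))
  ... | tri< h _ _ = i , (differ , maximal) , first , h
  ... | tri≈ _ e _ = contradiction (pos-injective e) differ
  ... | tri> _ _ h with first-maximum-cong {D′ = λ j → lookup w′ j ≢ lookup w j} (λ j → ≢-sym) (λ j → ≢-sym)
                           (λ j → lcaRank-sym T (pos (lookup w j)) (pos (lookup w′ j))) i ((differ , maximal) , first)
  ...   | max , first′ = contradiction (PrecT⇒≺ w′ w (i , max , first′ , h)) (asym w≺w′)

-- Choice of the homogeneous cube and conclusion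

pull-⊙-homogeneous : ∀ {b d e n m} (p : PW b d n) (q : PW b e d) {_≺_ : Rel (Word b n) 0ℓ} →
                     Homogeneous m (pull q (pull p _≺_)) → Homogeneous m (pull (p ⊙ q) _≺_)
pull-⊙-homogeneous p q {_≺_} hom r r′ τ τ′ h =
  ≡.subst₂ _≺_ (sym (⟨⟩-⊙ p q (lookup (r′ ⟨ τ ⟩)))) (sym (⟨⟩-⊙ p q (lookup (r′ ⟨ τ′ ⟩))))
    (hom r r′ τ τ′ (≡.subst₂ _≺_ (⟨⟩-⊙ p q (lookup (r ⟨ τ ⟩))) (⟨⟩-⊙ p q (lookup (r ⟨ τ′ ⟩))) h))

-- Homogeneity is inherited by subcubes, so the cube for 1 parameter can be taken inside the one for
-- 2; its ambient dimension `n₁` therefore has to be fixed first.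
doubly-homogeneous-cube : ∀ b d → ∃ λ n → (_≺_ : Rel (Word (suc b) n) 0ℓ) → IsStrictTotalOrder _≡_ _≺_ →
                          Σ (PW (suc b) d n) λ p → Homogeneous 1 (pull p _≺_) × Homogeneous 2 (pull p _≺_)
doubly-homogeneous-cube b d with homogeneous-cube 1 b d
... | n₁ , cube₁ with homogeneous-cube 2 b n₁
... | n₂ , cube₂ = n₂ , cube
  where
  cube : (_≺_ : Rel (Word (suc b) n₂) 0ℓ) → IsStrictTotalOrder _≡_ _≺_ →
         Σ (PW (suc b) d n₂) λ p → Homogeneous 1 (pull p _≺_) × Homogeneous 2 (pull p _≺_)
  cube _≺_ sto with cube₂ _≺_ (IsStrictTotalOrder._<?_ sto)
  ... | p₂ , hom₂ with cube₁ (pull p₂ _≺_) (IsStrictTotalOrder._<?_ (pull-isStrictTotalOrder p₂ sto))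
  ... | p₁ , hom₁ = p₂ ⊙ p₁ , pull-⊙-homogeneous p₂ p₁ {_≺_} hom₁ ,
                    pull-⊙-homogeneous p₂ p₁ {_≺_} (pull-homogeneous p₁ {pull p₂ _≺_} hom₂)

HasCanonicalSubcube : (k d n : ℕ) → Rel (Word k n) 0ℓ → Set₁
HasCanonicalSubcube k d n _≺_ =
    Σ (PWord k d n) λ p → IsParamWord p × Canonical p ×
    Σ (Rel (Fin k) 0ℓ) λ _<ₖ_ → IsStrictTotalOrder _≡_ _<ₖ_ ×
    Σ (Fin k → Fin k) λ pos → Bijective _≡_ _≡_ pos ×
    (∀ a b → (a <ₖ b) ⇔ (pos a Fin.< pos b)) ×
    Σ (STree k) λ T → WeaklyDecreasing T ×
    (∀ (w w' : Word k d) → (subst p w ≺ subst p w') ⇔ PrecT _<ₖ_ pos T w w')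

homogeneous⇒canonical-subcube : ∀ k d {n} (p : PW (suc k) (suc d * (3 + k)) n) {_≺_ : Rel (Word (suc k) n) 0ℓ} →
                                IsStrictTotalOrder _≡_ _≺_ →
                                Homogeneous 1 (pull p _≺_) → Homogeneous 2 (pull p _≺_) →
                                HasCanonicalSubcube (suc k) (suc d) n _≺_
homogeneous⇒canonical-subcube k d {n} p {_≺_} sto hom₁ hom₂ =
    toPWord r , toPWord-isParamWord r , toPWord-canonical r ,
    _<ₖ_ , <ₖ-isStrictTotalOrder ,
    pos , (pos-injective , λ y → proj₁ (pos-surjective y) , λ { refl → proj₂ (pos-surjective y) }) ,
    (λ a b → mk⇔ id id) ,
    T , cartesian-WeaklyDecreasing k rank ,
    λ w w′ → mk⇔ (λ h → ≺⇒PrecT w w′ (≡.subst₂ _≺_ (value w) (value w′) h))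
                 (λ h → ≡.subst₂ _≺_ (sym (value w)) (sym (value w′)) (PrecT⇒≺ w w′ h))
  where
  open Blocks k d (pull p _≺_) (pull-isStrictTotalOrder p sto) hom₁ hom₂
    using (_<ₖ_; <ₖ-isStrictTotalOrder; pos; pos-injective; pos-surjective; T; rank; ≺⇒PrecT; PrecT⇒≺)
  r : PW (suc k) (suc d) n
  r = p ⊙ blocks (suc d) (2 + k)
  value : ∀ w → subst (toPWord r) w ≡ p ⟨ lookup (blocks (suc d) (2 + k) ⟨ lookup w ⟩) ⟩
  value w = trans (substitute-toPWord r w) (⟨⟩-⊙ p (blocks (suc d) (2 + k)) (lookup w))

theorem4 : (k d : ℕ) → 0 < k → 0 < d →
    ∃ λ (n : ℕ) →
    (_≺_ : Rel (Word k n) 0ℓ) → IsStrictTotalOrder _≡_ _≺_ →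
    Σ (PWord k d n) λ p → IsParamWord p × Canonical p ×
    Σ (Rel (Fin k) 0ℓ) λ _<ₖ_ → IsStrictTotalOrder _≡_ _<ₖ_ ×
    Σ (Fin k → Fin k) λ pos → Bijective _≡_ _≡_ pos ×
    (∀ a b → (a <ₖ b) ⇔ (pos a Fin.< pos b)) ×
    Σ (STree k) λ T → WeaklyDecreasing T ×
    (∀ (w w' : Word k d) → (subst p w ≺ subst p w') ⇔ PrecT _<ₖ_ pos T w w')
theorem4 (suc k) (suc d) _ _ with doubly-homogeneous-cube k (suc d * (3 + k))
... | n , cube = n , λ _≺_ sto → let (p , hom₁ , hom₂) = cube _≺_ sto in
  homogeneous⇒canonical-subcube k d p sto hom₁ hom₂
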